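{- For every string $T$ of length $n$ with a utility function $w$ on its positions, and every integer $\tau$ with $1 \le \tau \le n$, there exists an $O(n\tau)$-space data structure for Useful String Indexing that can answer internal Useful String Indexing queries in time $O(1 + m/\tau)$: given two integers $i \le j$ specifying the pattern $P = T[i\,..\,j]$ of length $m = j-i+1$, it returns the global utility of $P$ in $T$ in $O(1+m/\tau)$ time.
   Context: A string with utilities is a pair $(T,w)$ consisting of a string $T$ of length $n$ and a function $w$ mapping each $i \in \{1,\dots,n\}$ to a real number $w[i]$. The Useful String Indexing problem is to preprocess $(T,w)$ so that, given a pattern $P$, its global utility in $T$ can be returned. $\mathrm{Occ}_T(P)$ is the set of starting positions of occurrences of $P$ in $T$. The global utility of a pattern $P$ of length $m$ in $T$ is $\sum_{i \in \mathrm{Occ}_T(P)} \sum_{j=i}^{i+m-1} w[j]$. In an internal query the pattern is specified in $O(1)$ time and space by two integers $i,j$ with $P=T[i\,..\,j]$. Space is measured in machine words in the standard word-RAM model; a utility value occupies one word and two values can be added or subtracted in $O(1)$ time. -}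

module Defs where

open import Algebra.Bundles using (AbelianGroup)
open import Data.Bool.Base using (Bool; true; false; if_then_else_; _∧_; _∨_; _xor_)
open import Data.Fin.Base using (Fin; toℕ; fromℕ<)
open import Data.List.Base as List using (List; take; drop; filter; upTo; foldr; map; length)
open import Data.List.Properties using (≡-dec)
open import Data.Nat.Base
  using (ℕ; zero; suc; _+_; _*_; _∸_; _^_; _/_; _%_; _<_; _≡ᵇ_; _<ᵇ_)
open import Data.Nat.Properties using (m^n≢0)
open import Data.Product.Base using (Σ-syntax; _×_)
open import Data.Vec.Base as Vec using (Vec)
open import Data.Vec.Functional using (Vector; toList; updateAt)
open import Function.Base using (const)
open import Level using (Level; _⊔_)
open import Relation.Binary.Definitions using (DecidableEquality)
open import Relation.Binary.PropositionalEquality using (_≡_; _≢_)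

private
  variable
    a c ℓ : Level

-- Positions of a string of length n are 0, …, n-1.

-- The part of xs that starts at position i and has length m; it is shorter
-- than m exactly when it would run past the end of xs.
slice : {A : Set a} → List A → ℕ → ℕ → List A
slice xs i m = take m (drop i xs)

-- T[i .. j], both ends included.
factor : {A : Set a} {n : ℕ} → Vector A n → Fin n → Fin n → List A
factor T i j = slice (toList T) (toℕ i) (suc (toℕ j) ∸ toℕ i)

Occ : {A : Set a} → DecidableEquality A → {n : ℕ} → Vector A n → List A → List ℕ
Occ _≟_ {n} T P = filter (λ i → ≡-dec _≟_ (slice (toList T) i (length P)) P) (upTo n)

module _ (G : AbelianGroup c ℓ) where
  open AbelianGroup G using (Carrier; _∙_; ε)

  ∑ : List Carrier → Carrier
  ∑ = foldr _∙_ ε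

  globalUtility : {A : Set a} → DecidableEquality A → {n : ℕ} →
                  Vector A n → Vector Carrier n → List A → Carrier
  globalUtility _≟_ T w P =
    ∑ (map (λ i → ∑ (slice (toList w) i (length P))) (Occ _≟_ T P))

-- Word RAM with words of W bits.  Programs are structured (sequence, branch,
-- loop) rather than lists of jumps.  Words and utilities are kept apart: each
-- kind has its own registers and its own memory bank, both banks being
-- addressed by words.  Utilities are opaque: they can only be copied, added
-- and subtracted.

Reg : Set
Reg = ℕ

data WordOp : Set where
  add sub mul div mod and or xor shl shr eq lt : WordOp

data Program : Set where
  skip         : Program
  _⨾_          : Program → Program → Program
  ifNonZero    : Reg → (then else : Program) → Program
  whileNonZero : Reg → (body : Program) → Program
  setConst     : (dst : Reg) → ℕ → Program
  setOp        : (dst : Reg) → WordOp → (x y : Reg) → Program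
  load store   : (reg addr : Reg) → Program
  addU subU    : (dst x y : Reg) → Program
  loadU storeU : (reg addr : Reg) → Program

infixr 5 _⨾_

module WordArithmetic (W : ℕ) where

  wrap : ℕ → ℕ
  wrap x = _%_ x (2 ^ W) {{m^n≢0 2 W}}

  -- Least significant bit first.
  toBits : (k : ℕ) → ℕ → Vec Bool k
  toBits zero    x = Vec.[]
  toBits (suc k) x = (x % 2 ≡ᵇ 1) Vec.∷ toBits k (x / 2)

  bit : Bool → ℕ
  bit b = if b then 1 else 0

  fromBits : {k : ℕ} → Vec Bool k → ℕ
  fromBits Vec.[]       = 0
  fromBits (b Vec.∷ bs) = bit b + 2 * fromBits bs

  bitwise : (Bool → Bool → Bool) → ℕ → ℕ → ℕ
  bitwise f x y = fromBits (Vec.zipWith f (toBits W x) (toBits W y))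

  -- Division and remainder by zero give 0; subtraction is modulo 2 ^ W.
  eval : WordOp → ℕ → ℕ → ℕ
  eval add x y       = wrap (x + y)
  eval sub x y       = wrap (x + (2 ^ W ∸ y))
  eval mul x y       = wrap (x * y)
  eval div x zero    = 0
  eval div x (suc y) = x / suc y
  eval mod x zero    = 0
  eval mod x (suc y) = x % suc y
  eval and x y       = bitwise _∧_ x y
  eval or  x y       = bitwise _∨_ x y
  eval xor x y       = bitwise _xor_ x y
  eval shl x y       = wrap (x * 2 ^ y)
  eval shr x y       = _/_ x (2 ^ y) {{m^n≢0 2 y}}
  eval eq  x y       = bit (x ≡ᵇ y)
  eval lt  x y       = bit (x <ᵇ y)

_[_↦_] : {A : Set a} → (Reg → A) → Reg → A → (Reg → A)
(ρ [ r ↦ v ]) r′ = if r ≡ᵇ r′ then v else ρ r′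

module WordRAM (G : AbelianGroup c ℓ) (W : ℕ) where
  open AbelianGroup G using (Carrier; _∙_; ε; _⁻¹)
  open WordArithmetic W

  record Memory : Set c where
    field
      wordCells utilCells : ℕ
      words               : Vector ℕ wordCells
      utils               : Vector Carrier utilCells
      fits                : ∀ k → words k < 2 ^ W

    space : ℕ
    space = wordCells + utilCells

  record State (s u : ℕ) : Set c where
    constructor state
    field
      reg   : Reg → ℕ
      ureg  : Reg → Carrier
      words : Vector ℕ s
      utils : Vector Carrier u

  private
    variable
      s u t t₁ t₂ : ℕ
      p q         : Program
      σ σ₁ σ₂     : State s u
      ρ           : Reg → ℕ
      υ           : Reg → Carrier
      M           : Vector ℕ s
      N           : Vector Carrier u
      d r x y k   : ℕ
      o           : WordOp

  -- ⟨ p , σ ⟩⇓ σ′ [ t ] : p started in σ halts in σ′ after t unit-cost steps.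
  -- There is no rule for an access outside the allocated memory.
  data ⟨_,_⟩⇓_[_] {s u : ℕ} : Program → State s u → State s u → ℕ → Set c where

    ⇓skip : ⟨ skip , σ ⟩⇓ σ [ 0 ]

    ⇓seq : ⟨ p , σ ⟩⇓ σ₁ [ t₁ ] → ⟨ q , σ₁ ⟩⇓ σ₂ [ t₂ ] →
           ⟨ p ⨾ q , σ ⟩⇓ σ₂ [ t₁ + t₂ ]

    ⇓then : State.reg σ r ≢ 0 → ⟨ p , σ ⟩⇓ σ₁ [ t ] →
            ⟨ ifNonZero r p q , σ ⟩⇓ σ₁ [ suc t ]

    ⇓else : State.reg σ r ≡ 0 → ⟨ q , σ ⟩⇓ σ₁ [ t ] →
            ⟨ ifNonZero r p q , σ ⟩⇓ σ₁ [ suc t ]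

    ⇓stop : State.reg σ r ≡ 0 →
            ⟨ whileNonZero r p , σ ⟩⇓ σ [ 1 ]

    ⇓loop : State.reg σ r ≢ 0 →
            ⟨ p , σ ⟩⇓ σ₁ [ t₁ ] → ⟨ whileNonZero r p , σ₁ ⟩⇓ σ₂ [ t₂ ] →
            ⟨ whileNonZero r p , σ ⟩⇓ σ₂ [ suc (t₁ + t₂) ]

    ⇓const : ⟨ setConst d k , state ρ υ M N ⟩⇓
             state (ρ [ d ↦ wrap k ]) υ M N [ 1 ]

    ⇓op : ⟨ setOp d o x y , state ρ υ M N ⟩⇓
          state (ρ [ d ↦ eval o (ρ x) (ρ y) ]) υ M N [ 1 ]

    ⇓load : (i< : ρ x < s) →
            ⟨ load r x , state ρ υ M N ⟩⇓
            state (ρ [ r ↦ M (fromℕ< i<) ]) υ M N [ 1 ]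

    ⇓store : (i< : ρ x < s) →
             ⟨ store r x , state ρ υ M N ⟩⇓
             state ρ υ (updateAt M (fromℕ< i<) (const (ρ r))) N [ 1 ]

    ⇓addU : ⟨ addU d x y , state ρ υ M N ⟩⇓
            state ρ (υ [ d ↦ υ x ∙ υ y ]) M N [ 1 ]

    ⇓subU : ⟨ subU d x y , state ρ υ M N ⟩⇓
            state ρ (υ [ d ↦ υ x ∙ (υ y ⁻¹) ]) M N [ 1 ]

    ⇓loadU : (i< : ρ x < u) →
             ⟨ loadU r x , state ρ υ M N ⟩⇓
             state ρ (υ [ r ↦ N (fromℕ< i<) ]) M N [ 1 ]

    ⇓storeU : (i< : ρ x < u) →
              ⟨ storeU r x , state ρ υ M N ⟩⇓
              state ρ υ M (updateAt N (fromℕ< i<) (const (υ r))) [ 1 ]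

  -- The query (i , j) is passed in word registers 0 and 1; all other
  -- registers start out zero.
  initial : (D : Memory) → ℕ → ℕ → State (Memory.wordCells D) (Memory.utilCells D)
  initial D i j =
    state ((const 0 [ 0 ↦ i ]) [ 1 ↦ j ]) (const ε) (Memory.words D) (Memory.utils D)

  -- On query (i , j) the program halts after t steps with v in utility
  -- register 0.  The memory has to be left as it was found, so
  -- that any sequence of queries can be answered.
  Answers : Program → Memory → ℕ → ℕ → Carrier → ℕ → Set (c ⊔ ℓ)
  Answers p D i j v t =
    Σ[ σ ∈ State (Memory.wordCells D) (Memory.utilCells D) ]
      ⟨ p , initial D i j ⟩⇓ σ [ t ]
      × (State.ureg σ 0 ≈ v)
      × (∀ k → State.words σ k ≡ Memory.words D k)
      × (∀ k → State.utils σ k ≈ Memory.utils D k)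
    where open AbelianGroup G using (_≈_)

{-# OPTIONS --safe #-}

-- With S[k] the utility of the first k positions, the global utility of a
-- pattern of length m is the sum of S[e + 1] over the ends e of its
-- occurrences minus the sum of S[i] over their starts i.  In the sorted list of
-- suffixes the starts form an interval, and in that of the reversed prefixes so
-- do the ends, so prefix sums along these lists reduce a query to finding the
-- boundaries of intervals: the last place p′ ≤ p at which the array H of longest
-- common prefixes of neighbours is below m.  A search tree of minima of H finds
-- p′ by climbing and descending again.  It climbs at most m / τ levels: if p′ is
-- still not found, it is read from a table indexed by the node reached and by
-- m % τ.  Since the height of that node is m / τ, node and remainder determine m,
-- and a table of O(nτ) entries serves all lengths.
module Submission where

open import Defs
open import Algebra.Bundles using (AbelianGroup)
import Algebra.Properties.AbelianGroup as AbelianGroupProperties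
import Algebra.Properties.CommutativeSemigroup as CommutativeSemigroupProperties
open import Data.Bool.Base using (true; false; if_then_else_; T)
open import Data.Fin.Base using (Fin; toℕ; fromℕ<)
open import Data.Fin.Properties using (toℕ-fromℕ<; toℕ<n)
open import Data.List.Base using (List; []; _∷_; _++_; map; filter; take; drop; length; upTo; applyUpTo)
open import Data.List.Membership.Propositional using (_∈_)
open import Data.List.Membership.Propositional.Properties using (∈-upTo⁺)
open import Data.List.Properties
  using (length-upTo; length-take; length-drop; length-tabulate; filter-++; filter-all; filter-none;
         filter-accept; filter-reject; filter-≐; take++drop≡id; ++-identityʳ; map-∘; map-upTo; ∷-injective)
open import Data.List.Relation.Binary.Permutation.Propositional using (_↭_; ↭⇒↭ₛ; ↭-sym)
open import Data.List.Relation.Binary.Permutation.Propositional.Properties using (∈-resp-↭; ↭-length; filter-↭)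
import Data.List.Relation.Binary.Permutation.Setoid.Properties as PermSetoid
open import Data.List.Relation.Unary.All using (All; []; _∷_)
open import Data.List.Relation.Unary.All.Properties using (applyUpTo⁺₁)
open import Data.List.Relation.Unary.AllPairs using (AllPairs; []; _∷_)
open import Data.List.Relation.Unary.Any using (here; there)
open import Data.List.Relation.Unary.Sorted.TotalOrder.Properties using (Sorted⇒AllPairs)
import Data.List.Sort
open import Data.Maybe.Base using (Maybe; just; nothing)
open import Data.Maybe.Properties using (just-injective)
open import Data.Nat.Base hiding (_⊔_)
open import Data.Nat.DivMod hiding (_div_; _mod_)
open import Data.Nat.Properties
open import Data.Nat.Tactic.RingSolver using (solve-∀)
open import Data.Product.Base using (Σ-syntax; ∃-syntax; _×_; _,_; proj₁; proj₂)
open import Data.Sum.Base using (_⊎_; inj₁; inj₂)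
open import Data.Vec.Functional using (Vector; toList)
open import Function.Base using (_∘_; const; id)
open import Level using (_⊔_)
open import Relation.Binary.Bundles using (DecTotalOrder)
import Relation.Binary.Construct.On as On
open import Relation.Binary.Definitions using (DecidableEquality; Tri; tri<; tri≈; tri>)
open import Relation.Binary.PropositionalEquality as ≡
  using (_≡_; _≢_; refl; sym; trans; cong; cong₂; subst; subst₂; module ≡-Reasoning)
open import Relation.Nullary using (¬_; Dec; yes; no; contradiction)
open import Relation.Unary using (Pred; Decidable)

-- Prefix sums of S[i + m] along the suffixes alone would depend on `m` and need one table per
-- length. Charging S[e + 1] to the end `e` leaves weights that depend on a single position; the
-- price is a second order, in which the ends become contiguous.
--
-- Only left boundaries are ever searched for. The right boundary of an interval is a left boundary
-- in the opposite order, so both orders are also kept reversed. The query starts from the total of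
-- all weights and subtracts four sums, each over the positions strictly to one side of the matches.
-- One lookup program with one proof thus serves all four boundaries.
--
-- A climb that succeeds after some levels has exactly that many to descend, and one that exhausts
-- its budget is handed a leaf and descends none, so the way down never costs more than the way up
-- was allowed to.

halve : ∀ x → (x ≡ x / 2 + x / 2 × x % 2 ≡ 0) ⊎ (x ≡ suc (x / 2 + x / 2) × x % 2 ≡ 1)
halve x with x % 2 | m≡m%n+[m/n]*n x 2 | m%n<n x 2
... | 0 | e≡ | _ = inj₁ (trans e≡ (double (x / 2)) , refl)
  where double : ∀ y → y * 2 ≡ y + y
        double = solve-∀
... | 1 | e≡ | _ = inj₂ (trans e≡ (cong suc (double (x / 2))) , refl)
  where double : ∀ y → y * 2 ≡ y + y
        double = solve-∀
... | suc (suc _) | _ | s≤s (s≤s ())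

double-pow : ∀ x e → (x + x) * 2 ^ e ≡ x * 2 ^ suc e
double-pow x e = lemma x (2 ^ e)
  where lemma : ∀ x p → (x + x) * p ≡ x * (p + (p + 0))
        lemma = solve-∀

double-cancel-< : ∀ x y → x + x < y + y → x < y
double-cancel-< x y lt′ with x <? y
... | yes x<y = x<y
... | no  x≮y = contradiction (+-mono-≤ (≮⇒≥ x≮y) (≮⇒≥ x≮y)) (<⇒≱ lt′)

double-cancel-≤ : ∀ x y → x + x ≤ suc (y + y) → x ≤ y
double-cancel-≤ x y le with x ≤? y
... | yes x≤y = x≤y
... | no  x≰y = contradiction le (<⇒≱ 
  (≤-trans (≤-reflexive (cong suc (sym (+-suc y y)))) (+-mono-≤ (≰⇒> x≰y) (≰⇒> x≰y))))

pow-double : ∀ d → 2 ^ suc d ≡ 2 ^ d + 2 ^ d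
pow-double d = cong (2 ^ d +_) (+-identityʳ (2 ^ d))

-- Search for the last small value before a given place

-- The complete binary tree whose root is 1 and whose node x has the children
-- x + x and x + x + 1; its leaves, at depth K, are N, …, 2N - 1.
module Tree (K : ℕ) (H : ℕ → ℕ) where

  N : ℕ
  N = 2 ^ K

  record Node (d x : ℕ) : Set where
    constructor _,_
    field
      lower : 2 ^ d ≤ x
      upper : x < 2 ^ suc d

  open Node

  childˡ : ∀ {d x} → Node d x → Node (suc d) (x + x)
  childˡ {d} {x} (lo , hi) = subst (_≤ x + x) (sym (pow-double d)) (+-mono-≤ lo lo) ,
    subst (x + x <_) (sym (pow-double (suc d))) (+-mono-< hi hi)

  childʳ : ∀ {d x} → Node d x → Node (suc d) (suc (x + x))
  childʳ {d} {x} nd@(lo , hi) = m≤n⇒m≤1+n (lower (childˡ nd)) ,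
    subst (suc (x + x) <_) (sym (pow-double (suc d)))
      (≤-trans (≤-reflexive (cong suc (sym (+-suc x x)))) (+-mono-≤ hi hi))

  -- The height of node x above the leaves, provided that k is at least that.
  height : ℕ → ℕ → ℕ
  height zero    x = 0
  height (suc k) x = if N ≤ᵇ x then 0 else suc (height k (x + x))

  -- Tables are indexed by the number of a node alone, while the search invariants carry its height;
  -- this identifies the two.
  height-node : ∀ e k {d x} → e ≤ k → Node d x → d + e ≡ K → height k x ≡ e
  height-node zero zero    _ _ _ = refl
  height-node zero (suc k) {d} {x} _ (lo , _) e≡ 
    with N ≤ᵇ x | ≤⇒≤ᵇ {N} {x} (subst (λ a → 2 ^ a ≤ x) (trans (sym (+-identityʳ d)) e≡) lo)
  ... | true | _ = refl
  height-node (suc e) (suc k) {d} {x} (s≤s e≤k) nd@(_ , hi) e≡ with N ≤ᵇ x | ≤ᵇ⇒≤ N x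
  ... | false | _ = cong suc (height-node e k e≤k (childˡ nd) (trans (sym (+-suc d e)) e≡))
  ... | true | N≤x = contradiction (N≤x _) (<⇒≱ (<-≤-trans hi
          (^-monoʳ-≤ 2 (subst (suc d ≤_) (trans (sym (+-suc d e)) e≡) (m≤m+n (suc d) e)))))

  -- The first argument is the height of the node. The leaves under `x` at height `e` are those from
  -- `x * 2 ^ e` up to, but excluding, `suc x * 2 ^ e`.
  minAt : ℕ → ℕ → ℕ
  minAt zero    x = H x
  minAt (suc e) x = minAt e (x + x) ⊓ minAt e (suc (x + x))

  minAt-≤ : ∀ {c} → (∀ l → H l ≤ c) → ∀ e x → minAt e x ≤ c
  minAt-≤ H≤ zero    x = H≤ x
  minAt-≤ H≤ (suc e) x = ≤-trans (m⊓n≤m _ _) (minAt-≤ H≤ e (x + x))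

  -- The last l < s with H l < m; junk value 0 if there is none.
  lastBelow : ℕ → ℕ → ℕ
  lastBelow m zero    = 0
  lastBelow m (suc s) = if H s <ᵇ m then s else lastBelow m s

  Clear : ℕ → ℕ → ℕ → Set
  Clear m a z = ∀ l → a ≤ l → l < z → m ≤ H l

  clear-++ : ∀ {m a b z} → Clear m a b → Clear m b z → Clear m a z
  clear-++ {b = b} c₁ c₂ l a≤l l<z with l <? b
  ... | yes l<b = c₁ l a≤l l<b
  ... | no  l≮b = c₂ l (≮⇒≥ l≮b) l<z

  minAt-clear : ∀ {m} e x → m ≤ minAt e x → Clear m (x * 2 ^ e) (suc x * 2 ^ e)
  minAt-clear zero x m≤ l lo hi = subst (λ a → _ ≤ H a)
    (≤-antisym (subst (_≤ l) (*-identityʳ x) lo) (m<1+n⇒m≤n (subst (l <_) (*-identityʳ (suc x)) hi))) m≤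
  minAt-clear {m} (suc e) x m≤ = subst₂ (Clear m) (double-pow x e) e≡
     (clear-++ (minAt-clear e (x + x) (≤-trans m≤ (m⊓n≤m _ _)))
               (minAt-clear e (suc (x + x)) (≤-trans m≤ (m⊓n≤n (minAt e (x + x)) _))))
    where
    e≡ : suc (suc (x + x)) * 2 ^ e ≡ suc x * 2 ^ suc e
    e≡ = trans (cong (λ a → suc a * 2 ^ e) (sym (+-suc x x))) (double-pow (suc x) e)

  record IsLast (m z l : ℕ) : Set where
    field
      leaf   : N ≤ l
      before : l < z
      below  : H l < m
      clear  : Clear m (suc l) z

  -- The witness `a` keeps the downward scan from passing below the leaves, and so rules out the
  -- junk value.
  lastBelow-isLast : ∀ {m a} s → N ≤ a → a < s → H a < m → IsLast m s (lastBelow m s)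
  lastBelow-isLast {m} {a} (suc s) N≤a a<1+s Ha<m with H s <ᵇ m in e≡
  ... | true  = record { leaf = ≤-trans N≤a (m<1+n⇒m≤n a<1+s) ; before = ≤-refl
                       ; below = <ᵇ⇒< _ _ (subst T (sym e≡) _)
                       ; clear = λ l lo hi → contradiction lo (<⇒≱ hi) }
  ... | false = record
    { leaf = leaf ; before = m≤n⇒m≤1+n before ; below = below
    ; clear = clear-++ clear λ l lo hi → subst (λ a → m ≤ H a) (≤-antisym lo (m<1+n⇒m≤n hi)) m≤Hs }
    where
    m≤Hs : m ≤ H s
    m≤Hs = ≮⇒≥ λ Hs<m → subst T e≡ (<⇒<ᵇ Hs<m)
    a<s : a < s
    a<s = ≤∧≢⇒< (m<1+n⇒m≤n a<1+s) λ { refl → <⇒≱ Ha<m m≤Hs }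
    open IsLast (lastBelow-isLast s N≤a a<s Ha<m)

  -- The last leaf before z with H below m lies under the node y of height e.
  record Found (m z e y : ℕ) : Set where
    field
      {depth} : ℕ
      node    : Node depth y
      heightʸ : depth + e ≡ K
      before  : suc y * 2 ^ e ≤ z
      below   : minAt e y < m
      clear   : Clear m (suc y * 2 ^ e) z

  isLast⇒found : ∀ {m z l} → z ≤ N + N → IsLast m z l → Found m z 0 l
  isLast⇒found {m} {z} {l} z≤2N il = record
    { node = leaf , subst (l <_) (sym (pow-double K)) (<-≤-trans before z≤2N)
    ; heightʸ = +-identityʳ K
    ; before = subst (_≤ z) (sym (*-identityʳ (suc l))) before
    ; below = below
    ; clear = subst (λ a → Clear m a z) (sym (*-identityʳ (suc l))) clear }
    where open IsLast il

  found⇒isLast : ∀ {m z l} → Found m z 0 l → IsLast m z l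
  found⇒isLast {m} {z} {l} f = record
    { leaf = subst (λ a → 2 ^ a ≤ l) (trans (sym (+-identityʳ depth)) heightʸ) (lower node)
    ; before = subst (_≤ z) (*-identityʳ (suc l)) before
    ; below = below
    ; clear = subst (λ a → Clear m a z) (*-identityʳ (suc l)) clear }
    where open Found f

  found-inner : ∀ {m z e y} → Found m z (suc e) y → y < N
  found-inner {e = e} f = <-≤-trans (upper node)
    (^-monoʳ-≤ 2 (subst (suc depth ≤_) (trans (sym (+-suc depth e)) heightʸ) (m≤m+n (suc depth) e)))
    where open Found f

  module _ {m z e y : ℕ} (f : Found m z (suc e) y) where
    open Found f

    private
      end : suc (suc (y + y)) * 2 ^ e ≡ suc y * 2 ^ suc e
      end = trans (cong (λ a → suc a * 2 ^ e) (sym (+-suc y y))) (double-pow (suc y) e)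

    foundʳ : minAt e (suc (y + y)) < m → Found m z e (suc (y + y))
    foundʳ lt′ = record
      { node = childʳ node ; heightʸ = trans (sym (+-suc depth e)) heightʸ
      ; before = subst (_≤ z) (sym end) before ; below = lt′
      ; clear = subst (λ a → Clear m a z) (sym end) clear }

    -- A minimum below `m` at `y` that is not attained under the right child must be attained under
    -- the left one. The leaves of the right child then join the clear stretch.
    foundˡ : m ≤ minAt e (suc (y + y)) → Found m z e (y + y)
    foundˡ le = record
      { node = childˡ node ; heightʸ = trans (sym (+-suc depth e)) heightʸ
      ; before = ≤-trans (subst (suc (y + y) * 2 ^ e ≤_) end (*-monoˡ-≤ (2 ^ e) (n≤1+n (suc (y + y))))) before
      ; below = below-left
      ; clear = clear-++ (minAt-clear e (suc (y + y)) le) (subst (λ a → Clear m a z) (sym end) clear) }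
      where
      below-left : minAt e (y + y) < m
      below-left with minAt e (y + y) <? m
      ... | yes lt′ = lt′
      ... | no ≮m  = contradiction (⊓-glb (≮⇒≥ ≮m) le) (<⇒≱ below)

  -- The search has reached the node x of height e, and no leaf from the first
  -- one under x up to z has H below m.
  record Frontier (m z e x : ℕ) : Set where
    field
      {depth} : ℕ
      node    : Node depth x
      heightˣ : depth + e ≡ K
      start   : x * 2 ^ e ≤ z
      clear   : Clear m (x * 2 ^ e) z

    inHeap : x < N + N
    inHeap = <-≤-trans (upper node) (subst (2 ^ suc depth ≤_) (pow-double K)
               (^-monoʳ-≤ 2 (s≤s (m+n≤o⇒m≤o depth (≤-reflexive heightˣ)))))

  frontier-init : ∀ {m z} → N ≤ z → z < N + N → Frontier m z 0 z
  frontier-init {m} {z} N≤z z<2N = record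
    { node = N≤z , subst (z <_) (sym (pow-double K)) z<2N
    ; heightˣ = +-identityʳ K ; start = ≤-reflexive (*-identityʳ z)
    ; clear = λ l lo hi → contradiction (subst (_≤ l) (*-identityʳ z) lo) (<⇒≱ hi) }

  module _ {m z e x : ℕ} (1≤m : 1 ≤ m) (H0 : H N ≡ 0) (N<z : N < z) (f : Frontier m z e x) where
    open Frontier f

    private
      first : 2 ^ depth * 2 ^ e ≡ N
      first = trans (sym (^-distribˡ-+-* 2 depth e)) (cong (2 ^_) heightˣ)

      -- The leaf `N` is always below `m`, so the clear stretch cannot reach it and `x` is not
      -- leftmost on its level. Hence `x ∸ 1` is a node of the same level, and `x` is never the
      -- root: the climb cannot leave the tree even if its budget exceeds `K`.
      notFirst : 2 ^ depth < x
      notFirst = ≤∧≢⇒< (lower node) λ e≡ →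
        contradiction (clear N (≤-reflexive (trans (cong (_* 2 ^ e) (sym e≡)) first)) N<z)
          (subst (λ a → ¬ (m ≤ a)) (sym H0) (<⇒≱ 1≤m))

    frontier-lastBelow : IsLast m z (lastBelow m (x * 2 ^ e))
    frontier-lastBelow = record { leaf = I.leaf ; before = <-≤-trans I.before start ; below = I.below
                                ; clear = clear-++ I.clear clear }
      where
      module I = IsLast (lastBelow-isLast {m} {N} (x * 2 ^ e) ≤-refl
        (subst (_< x * 2 ^ e) first (*-monoˡ-< (2 ^ e) {{m^n≢0 2 e}} notFirst)) (subst (_< m) (sym H0) 1≤m))

    frontier-found : x % 2 ≡ 1 → minAt e (x ∸ 1) < m → Found m z e (x ∸ 1)
    frontier-found odd lt′ = record
      { node = ∸-monoˡ-≤ 1 notFirst , ≤-<-trans (m∸n≤m x 1) (upper node)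
      ; heightʸ = heightˣ
      ; before = subst (λ a → a * 2 ^ e ≤ z) (sym suc[x∸1]) start
      ; below = lt′
      ; clear = subst (λ a → Clear m (a * 2 ^ e) z) (sym suc[x∸1]) clear }
      where
      suc[x∸1] : suc (x ∸ 1) ≡ x
      suc[x∸1] = m+[n∸m]≡n {1} {x} (≤-trans (s≤s z≤n) notFirst)

    -- A left child begins at the same leaf as its parent, so nothing changes. For a right child the
    -- parent also covers the left sibling, whose leaves are clear by its minimum.
    frontier-up : (x % 2 ≡ 1 → m ≤ minAt e (x ∸ 1)) → Frontier m z (suc e) (x / 2)
    frontier-up right≥ with depth | node | heightˣ | notFirst | halve x
    ... | zero | (_ , hi) | _ | 1<x | _ = contradiction hi (≤⇒≯ 1<x)
    ... | suc d | (lo , hi) | hx | first<x | inj₁ (e≡ , _) = record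
      { node = double-cancel-≤ _ _ (m≤n⇒m≤1+n (subst₂ _≤_ (pow-double d) e≡ lo))
             , double-cancel-< _ _ (subst₂ _<_ e≡ (pow-double (suc d)) hi)
      ; heightˣ = trans (+-suc d e) hx
      ; start = subst (_≤ z) same start
      ; clear = subst (λ a → Clear m a z) same clear }
      where
      same : x * 2 ^ e ≡ x / 2 * 2 ^ suc e
      same = trans (cong (_* 2 ^ e) e≡) (double-pow (x / 2) e)
    ... | suc d | (lo , hi) | hx | first<x | inj₂ (e≡ , odd) = record
      { node = double-cancel-≤ _ _ (subst₂ _≤_ (pow-double d) e≡ lo)
             , double-cancel-< _ _ (<-trans (n<1+n _) (subst₂ _<_ e≡ (pow-double (suc d)) hi))
      ; heightˣ = trans (+-suc d e) hx
      ; start = ≤-trans (subst (_≤ x * 2 ^ e) (double-pow (x / 2) e)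
                   (*-monoˡ-≤ (2 ^ e) (≤-trans (n≤1+n _) (≤-reflexive (sym e≡))))) start
      ; clear = clear-++ (subst₂ (Clear m) (double-pow (x / 2) e) (cong (_* 2 ^ e) (sym e≡))
                  (minAt-clear e (x / 2 + x / 2) (subst (λ a → m ≤ minAt e (a ∸ 1)) e≡ (right≥ odd)))) clear }

-- Sorting by coherent keys

-- 0 past the end of the list.
nth : List ℕ → ℕ → ℕ
nth []       k       = 0
nth (x ∷ xs) zero    = x
nth (x ∷ xs) (suc k) = nth xs k

indexOf : List ℕ → ℕ → ℕ
indexOf []       y = 0
indexOf (x ∷ xs) y = if x ≡ᵇ y then 0 else suc (indexOf xs y)

indexOf-∈ : ∀ {xs y} → y ∈ xs → indexOf xs y < length xs × nth xs (indexOf xs y) ≡ y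
indexOf-∈ {x ∷ xs} {y} y∈ with x ≡ᵇ y in e≡
... | true  = s≤s z≤n , ≡ᵇ⇒≡ x y (subst T (sym e≡) _)
indexOf-∈ {x ∷ xs} {y} (here refl) | false = contradiction (≡⇒≡ᵇ y y refl) (subst T e≡)
indexOf-∈ {x ∷ xs} {y} (there y∈)  | false with indexOf-∈ y∈
... | lt′ , eq′ = s≤s lt′ , eq′

nth-All : ∀ {p} {P : Pred ℕ p} {xs} → All P xs → ∀ {k} → k < length xs → P (nth xs k)
nth-All (px ∷ pxs) {zero}  _         = px
nth-All (px ∷ pxs) {suc k} (s≤s k<) = nth-All pxs k<

nth-AllPairs : ∀ {r} {R : ℕ → ℕ → Set r} {xs} → (∀ {x} → R x x) → AllPairs R xs →
               ∀ {k l} → k ≤ l → l < length xs → R (nth xs k) (nth xs l)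
nth-AllPairs rfl (_ ∷ _)   {zero}  {zero}  _         _        = rfl
nth-AllPairs rfl (px ∷ _)  {zero}  {suc l} _         (s≤s l<) = nth-All px l<
nth-AllPairs rfl (_ ∷ pxs) {suc k} {suc l} (s≤s k≤l) (s≤s l<) = nth-AllPairs rfl pxs k≤l l<

take-nth : ∀ {p} {P : Pred ℕ p} q xs → (∀ k → k < q → k < length xs → P (nth xs k)) → All P (take q xs)
take-nth zero    xs       h = []
take-nth (suc q) []       h = []
take-nth (suc q) (x ∷ xs) h = h 0 (s≤s z≤n) (s≤s z≤n) ∷ take-nth q xs (λ k k<q k< → h (suc k) (s≤s k<q) (s≤s k<))

drop-nth : ∀ {p} {P : Pred ℕ p} q xs → (∀ k → q ≤ k → k < length xs → P (nth xs k)) → All P (drop q xs)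
drop-nth zero    []       h = []
drop-nth zero    (x ∷ xs) h = h 0 z≤n (s≤s z≤n) ∷ drop-nth zero xs (λ k _ k< → h (suc k) z≤n (s≤s k<))
drop-nth (suc q) []       h = []
drop-nth (suc q) (x ∷ xs) h = drop-nth q xs (λ k q≤k k< → h (suc k) (s≤s q≤k) (s≤s k<))

module Summation {c ℓ} (G : AbelianGroup c ℓ) where
  open AbelianGroup G renaming (refl to ≈-refl; sym to ≈-sym; trans to ≈-trans)

  ∑-++ : ∀ xs ys → ∑ G (xs ++ ys) ≈ ∑ G xs ∙ ∑ G ys
  ∑-++ []       ys = ≈-sym (identityˡ _)
  ∑-++ (x ∷ xs) ys = ≈-trans (∙-congˡ (∑-++ xs ys)) (≈-sym (assoc x _ _))

  ∑-map-cong : ∀ {b} {B : Set b} {f g : B → Carrier} → (∀ x → f x ≈ g x) → ∀ xs → ∑ G (map f xs) ≈ ∑ G (map g xs)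
  ∑-map-cong f≈g []       = ≈-refl
  ∑-map-cong f≈g (x ∷ xs) = ∙-cong (f≈g x) (∑-map-cong f≈g xs)

  ∑-↭ : ∀ {b} {B : Set b} (v : B → Carrier) {xs ys} → xs ↭ ys → ∑ G (map v xs) ≈ ∑ G (map v ys)
  ∑-↭ v p = PermSetoid.foldr-commMonoid setoid isCommutativeMonoid
    (PermSetoid.map⁺ (≡.setoid _) setoid (λ { refl → ≈-refl }) (↭⇒↭ₛ p))

-- `key m x` stands for the word of length `m` read at `x`. Coherence says that longer words refine
-- the order of shorter ones, so one list sorted by `key n` is sorted by every `key m` with `m ≤ n`.
module KeyOrder (n : ℕ) (key : ℕ → ℕ → ℕ)
  (coherent : ∀ m x y → key (suc m) x ≤ key (suc m) y → key m x ≤ key m y) where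

  key-mono : ∀ {m k x y} → m ≤′ k → key k x ≤ key k y → key m x ≤ key m y
  key-mono ≤′-refl        le = le
  key-mono (≤′-step m≤′k) le = key-mono m≤′k (coherent _ _ _ le)

  key-≡ : ∀ {m k x y} → m ≤ k → key k x ≡ key k y → key m x ≡ key m y
  key-≡ m≤k e≡ = ≤-antisym (key-mono (≤⇒≤′ m≤k) (≤-reflexive e≡)) (key-mono (≤⇒≤′ m≤k) (≤-reflexive (sym e≡)))

  order : DecTotalOrder _ _ _
  order = On.decTotalOrder ≤-decTotalOrder (key n)

  open Data.List.Sort order using (sort; sort-↭; sort-↗)

  sorted : List ℕ
  sorted = sort (upTo n)

  sorted-↭ : sorted ↭ upTo n
  sorted-↭ = sort-↭ (upTo n)

  length-sorted : length sorted ≡ n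
  length-sorted = trans (↭-length sorted-↭) (length-upTo n)

  rank : ℕ → ℕ
  rank = indexOf sorted

  rank-spec : ∀ {i} → i < n → rank i < n × nth sorted (rank i) ≡ i
  rank-spec i<n with indexOf-∈ (∈-resp-↭ (↭-sym sorted-↭) (∈-upTo⁺ i<n))
  ... | lt′ , e≡ = subst (rank _ <_) length-sorted lt′ , e≡

  nth-mono : ∀ {m k l} → m ≤ n → k ≤ l → l < n → key m (nth sorted k) ≤ key m (nth sorted l)
  nth-mono m≤n k≤l l<n = key-mono (≤⇒≤′ m≤n) (nth-AllPairs ≤-refl
    (Sorted⇒AllPairs (DecTotalOrder.totalOrder order) (sort-↗ (upTo n))) k≤l (subst (_<_ _) (sym length-sorted) l<n))

  commonUpTo : ℕ → ℕ → ℕ → ℕ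
  commonUpTo zero    x y = 0
  commonUpTo (suc k) x y = if key (suc k) x ≡ᵇ key (suc k) y then suc k else commonUpTo k x y

  commonUpTo-≤ : ∀ k x y → commonUpTo k x y ≤ k
  commonUpTo-≤ zero    x y = z≤n
  commonUpTo-≤ (suc k) x y with key (suc k) x ≡ᵇ key (suc k) y
  ... | true  = ≤-refl
  ... | false = m≤n⇒m≤1+n (commonUpTo-≤ k x y)

  ≡⇒≤common : ∀ {m x y} k → m ≤ k → key m x ≡ key m y → m ≤ commonUpTo k x y
  ≡⇒≤common zero z≤n e≡ = z≤n
  ≡⇒≤common {m} {x} {y} (suc k) m≤ e≡ with key (suc k) x ≡ᵇ key (suc k) y in test
  ... | true  = m≤
  ... | false = ≡⇒≤common k (m<1+n⇒m≤n (≤∧≢⇒< m≤ λ { refl → subst T test (≡⇒≡ᵇ _ _ e≡) })) e≡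

  -- The value 0 of `commonUpTo` is a default reached without any comparison, hence the restriction
  -- to `1 ≤ m`.
  ≤common⇒≡ : ∀ {m x y} k → 1 ≤ m → m ≤ commonUpTo k x y → key m x ≡ key m y
  ≤common⇒≡ zero 1≤m m≤ = contradiction m≤ (<⇒≱ 1≤m)
  ≤common⇒≡ {m} {x} {y} (suc k) 1≤m m≤ with key (suc k) x ≡ᵇ key (suc k) y in test
  ... | true  = key-≡ m≤ (≡ᵇ⇒≡ _ _ (subst T (sym test) _))
  ... | false = ≤common⇒≡ k 1≤m m≤

  -- How far an entry of the sorted list agrees with its predecessor; 0 for the
  -- first entry, so that every search for a value below m ≥ 1 succeeds.
  lcp : ℕ → ℕ
  lcp zero    = 0
  lcp (suc q) = commonUpTo n (nth sorted q) (nth sorted (suc q))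

  lcp-≤ : ∀ q → lcp q ≤ n
  lcp-≤ zero    = z≤n
  lcp-≤ (suc q) = commonUpTo-≤ n _ _

  module _ {m p q : ℕ} (1≤m : 1 ≤ m) (m≤n : m ≤ n) (p<n : p < n) (q≤p : q ≤ p) (lcp< : lcp q < m)
           (lcp≥ : ∀ k → q < k → k ≤ p → m ≤ lcp k) where

    private
      κ : ℕ
      κ = key m (nth sorted p)

      run : ∀ d k → k + d ≡ p → q ≤ k → key m (nth sorted k) ≡ κ
      run zero    k e≡ q≤k = cong (key m ∘ nth sorted) (trans (sym (+-identityʳ k)) e≡)
      run (suc d) k e≡ q≤k = trans
        (≤common⇒≡ n 1≤m (lcp≥ (suc k) (s≤s q≤k) (m+n≤o⇒m≤o (suc k) (≤-reflexive eq′))))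
        (run d (suc k) eq′ (m≤n⇒m≤1+n q≤k))
        where
        eq′ : suc k + d ≡ p
        eq′ = trans (sym (+-suc k d)) e≡

      at-q : key m (nth sorted q) ≡ κ
      at-q = run (p ∸ q) q (m+[n∸m]≡n q≤p) ≤-refl

      after : ∀ k → q ≤ k → k < length sorted → ¬ (key m (nth sorted k) < κ)
      after k q≤k k< lt′ = <⇒≱ lt′ (subst (_≤ key m (nth sorted k)) at-q (nth-mono m≤n q≤k (subst (k <_) length-sorted k<)))

      earlier : ∀ q → key m (nth sorted q) ≡ κ → q ≤ p → lcp q < m →
                ∀ k → k < q → key m (nth sorted k) < κ
      earlier (suc q′) at q<p lcp<′ k (s≤s k≤q′) = ≤-<-trans (nth-mono m≤n k≤q′ (<-trans q<p p<n))
        (≤∧≢⇒< (subst (key m (nth sorted q′) ≤_) at (nth-mono m≤n (n≤1+n q′) (≤-<-trans q<p p<n)))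
          λ e≡ → <⇒≱ lcp<′ (≡⇒≤common n m≤n (trans e≡ (sym at))))

    -- From `q` to `p` neighbours agree on `m` letters, so the key is constant there and, by
    -- sortedness, no smaller afterwards. At `q` the agreement with the predecessor breaks, so every
    -- earlier key is strictly smaller.
    filter-below : filter (λ x → key m x <? κ) sorted ≡ take q sorted
    filter-below = trans (cong (filter below?) (sym (take++drop≡id q sorted)))
      (trans (filter-++ below? (take q sorted) (drop q sorted))
      (trans (cong₂ _++_ (filter-all below? (take-nth q sorted λ k k<q _ → earlier q at-q q≤p lcp< k k<q))
                         (filter-none below? (drop-nth q sorted after)))
             (++-identityʳ _)))
      where
      below? : Decidable (λ x → key m x < κ)
      below? x = key m x <? κ

  lcpLeaf : ℕ → ℕ → ℕ
  lcpLeaf K l = lcp (l ∸ 2 ^ K)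

  module _ {c ℓ} (G : AbelianGroup c ℓ) (v : ℕ → AbelianGroup.Carrier G) where
    open AbelianGroup G using (Carrier; _≈_) renaming (trans to ≈-trans; reflexive to ≈-reflexive)
    open Summation G

    prefixSum : ℕ → Carrier
    prefixSum q = ∑ G (map v (take q sorted))

    -- Place `q` of the sorted list is leaf `2 ^ K + q`. Undoing the sorting permutation at the end
    -- expresses the sums of all four orders over the same list `upTo n`, where they can be
    -- combined.
    prefixSum-isLast : ∀ {K m i l} → 1 ≤ m → m ≤ n → i < n → 
      Tree.IsLast K (lcpLeaf K) m (2 ^ K + suc (rank i)) l →
      prefixSum (l ∸ 2 ^ K) ≈ ∑ G (map v (filter (λ x → key m x <? key m i) (upTo n)))
    prefixSum-isLast {K} {m} {i} {l} 1≤m m≤n i<n last = ≈-trans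
      (≈-reflexive (cong (∑ G ∘ map v) (trans
        (sym (filter-below 1≤m m≤n (proj₁ (rank-spec i<n)) q≤p below
          (λ k q<k k≤p → subst (λ a → m ≤ lcp a) (m+n∸m≡n (2 ^ K) k)
             (clear (2 ^ K + k) (≤-trans (s≤s (≤-reflexive (sym (m+[n∸m]≡n leaf))))
                                         (≤-trans (≤-reflexive (sym (+-suc (2 ^ K) _))) (+-monoʳ-≤ (2 ^ K) q<k)))
                                (+-monoʳ-< (2 ^ K) (s≤s k≤p))))))
        (cong (λ j → filter (λ x → key m x <? key m j) sorted) (proj₂ (rank-spec i<n))))))
      (∑-↭ v (filter-↭ (λ x → key m x <? key m i) sorted-↭))
      where
      open Tree.IsLast last
      q≤p : l ∸ 2 ^ K ≤ rank i
      q≤p = m<1+n⇒m≤n (subst (l ∸ 2 ^ K <_) (m+n∸m≡n (2 ^ K) (suc (rank i))) (∸-monoˡ-< before leaf))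

-- Words as numbers

-- The word d x 0, …, d x (m - 1) read as a number in base B.
module Positional (B : ℕ) (d : ℕ → ℕ → ℕ) (d<B : ∀ x k → d x k < B) where

  key : ℕ → ℕ → ℕ
  key zero    x = 0
  key (suc m) x = key m x * B + d x m

  -- A difference in the leading digits outweighs any last digit, since digits are below `B`.
  key-coherent : ∀ m x y → key (suc m) x ≤ key (suc m) y → key m x ≤ key m y
  key-coherent m x y le with key m x ≤? key m y
  ... | yes le′ = le′
  ... | no  ≰   = contradiction le (<⇒≱ (<-≤-trans (+-monoʳ-< (key m y * B) (d<B y m))
        (≤-trans (≤-reflexive (+-comm (key m y * B) B)) (≤-trans (*-monoˡ-≤ B (≰⇒> ≰)) (m≤m+n (key m x * B) (d x m))))))

  key⇒digits : ∀ {m x y} → key m x ≡ key m y → ∀ {k} → k < m → d x k ≡ d y k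
  key⇒digits {suc m} {x} {y} e≡ {k} k<1+m = step (m≤n⇒m<n∨m≡n (m<1+n⇒m≤n k<1+m))
    where
    init : key m x ≡ key m y
    init = ≤-antisym (key-coherent m x y (≤-reflexive e≡)) (key-coherent m y x (≤-reflexive (sym e≡)))
    step : k < m ⊎ k ≡ m → d x k ≡ d y k
    step (inj₁ k<m)  = key⇒digits init k<m
    step (inj₂ refl) = +-cancelˡ-≡ (key m y * B) _ _ (trans (cong (λ a → a * B + d x m) (sym init)) e≡)

  digits⇒key : ∀ m {x y} → (∀ {k} → k < m → d x k ≡ d y k) → key m x ≡ key m y
  digits⇒key zero    h = refl
  digits⇒key (suc m) h = cong₂ (λ a e → a * B + e) (digits⇒key m (h ∘ m≤n⇒m≤1+n)) (h ≤-refl)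

  key-< : ∀ m x → key m x < B ^ m
  key-< zero    x = s≤s z≤n
  key-< (suc m) x = <-≤-trans (+-monoʳ-< (key m x * B) (d<B x m))
    (≤-trans (≤-reflexive (+-comm (key m x * B) B)) (≤-trans (*-monoˡ-≤ B (key-< m x)) (≤-reflexive (*-comm (B ^ m) B))))

  -- Complementing reverses the order for each length while preserving coherence, so the words above
  -- the pattern become the words below it.
  cokey : ℕ → ℕ → ℕ
  cokey m x = B ^ m ∸ key m x

  cokey-coherent : ∀ m x y → cokey (suc m) x ≤ cokey (suc m) y → cokey m x ≤ cokey m y
  cokey-coherent m x y le = ∸-monoʳ-≤ (B ^ m) (key-coherent m y x (∸-cancelʳ-≤ (<⇒≤ (key-< (suc m) y)) le))

  cokey⇒key : ∀ m {x y} → cokey m x < cokey m y → key m y < key m x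
  cokey⇒key m = ∸-cancelʳ-<

  key⇒cokey : ∀ m {x y} → key m y < key m x → cokey m x < cokey m y
  key⇒cokey m {x} lt′ = ∸-monoʳ-< lt′ (<⇒≤ (key-< m x))

  key-cmp : ∀ m y x → Tri (key m x < key m y) (key m x ≡ key m y) (cokey m x < cokey m y)
  key-cmp m y x with <-cmp (key m x) (key m y)
  ... | tri< x<y x≢y y≮x = tri< x<y x≢y (y≮x ∘ cokey⇒key m)
  ... | tri≈ x≮y x≡y y≮x = tri≈ x≮y x≡y (y≮x ∘ cokey⇒key m)
  ... | tri> x≮y x≢y y<x = tri> x≮y x≢y (key⇒cokey m y<x)

-- Splitting and cancelling sums in an abelian group

module _ {c ℓ} (G : AbelianGroup c ℓ) where
  open AbelianGroup G renaming (refl to ≈-refl; sym to ≈-sym; trans to ≈-trans; reflexive to ≈-reflexive)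
  open AbelianGroupProperties G using (xyx⁻¹≈y)
  open CommutativeSemigroupProperties commutativeSemigroup using (x∙yz≈y∙xz)
  open import Relation.Binary.Reasoning.Setoid setoid

  ∑-trichotomy : ∀ {b p q r} {B : Set b} {P : Pred B p} {Q : Pred B q} {R : Pred B r}
    (P? : Decidable P) (Q? : Decidable Q) (R? : Decidable R) → (∀ x → Tri (P x) (Q x) (R x)) →
    (v : B → Carrier) (xs : List B) →
    ∑ G (map v xs) ≈ ∑ G (map v (filter P? xs)) ∙ (∑ G (map v (filter R? xs)) ∙ ∑ G (map v (filter Q? xs)))
  ∑-trichotomy P? Q? R? cmp v [] = ≈-sym (≈-trans (identityˡ _) (identityˡ _))
  ∑-trichotomy P? Q? R? cmp v (x ∷ xs) with ih ← ∑-trichotomy P? Q? R? cmp v xs | cmp x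
  ... | tri< p ¬q ¬r
    rewrite filter-accept P? {xs = xs} p
          | filter-reject Q? {xs = xs} ¬q
          | filter-reject R? {xs = xs} ¬r =
    ≈-trans (∙-congˡ ih) (≈-sym (assoc (v x) _ _))
  ... | tri≈ ¬p q ¬r
    rewrite filter-reject P? {xs = xs} ¬p
          | filter-accept Q? {xs = xs} q
          | filter-reject R? {xs = xs} ¬r =
    ≈-trans (∙-congˡ ih) (≈-trans (x∙yz≈y∙xz (v x) _ _) (∙-congˡ (x∙yz≈y∙xz (v x) _ _)))
  ... | tri> ¬p ¬q r
    rewrite filter-reject P? {xs = xs} ¬p
          | filter-reject Q? {xs = xs} ¬q
          | filter-accept R? {xs = xs} r =
    ≈-trans (∙-congˡ ih) (≈-trans (x∙yz≈y∙xz (v x) _ _) (∙-congˡ (≈-sym (assoc (v x) _ _))))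

  -- `a` and `b` are the sums over the matching starts and ends, the `x`s the sums over smaller and
  -- larger positions, removed in the order in which the query program removes them.
  subtract-four : ∀ x₁ x₂ x₃ x₄ a b →
    ((x₁ ∙ (x₂ ∙ a)) ∙ (x₃ ∙ (x₄ ∙ b))) ∙ x₁ ⁻¹ ∙ x₂ ⁻¹ ∙ x₃ ⁻¹ ∙ x₄ ⁻¹ ≈ a ∙ b
  subtract-four x₁ x₂ x₃ x₄ a b = begin
    ((x₁ ∙ (x₂ ∙ a)) ∙ (x₃ ∙ (x₄ ∙ b))) ∙ x₁ ⁻¹ ∙ x₂ ⁻¹ ∙ x₃ ⁻¹ ∙ x₄ ⁻¹
      ≈⟨ ∙-congʳ (∙-congʳ (∙-congʳ (∙-congʳ (≈-trans (assoc x₁ _ _) (∙-congˡ (≈-trans (assoc x₂ _ _)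
           (∙-congˡ (≈-trans (x∙yz≈y∙xz a x₃ _) (∙-congˡ (x∙yz≈y∙xz a x₄ b)))))))))) ⟩
    (x₁ ∙ (x₂ ∙ (x₃ ∙ (x₄ ∙ (a ∙ b))))) ∙ x₁ ⁻¹ ∙ x₂ ⁻¹ ∙ x₃ ⁻¹ ∙ x₄ ⁻¹  ≈⟨ ∙-congʳ (∙-congʳ (∙-congʳ (xyx⁻¹≈y x₁ _))) ⟩
    (x₂ ∙ (x₃ ∙ (x₄ ∙ (a ∙ b)))) ∙ x₂ ⁻¹ ∙ x₃ ⁻¹ ∙ x₄ ⁻¹                ≈⟨ ∙-congʳ (∙-congʳ (xyx⁻¹≈y x₂ _)) ⟩
    (x₃ ∙ (x₄ ∙ (a ∙ b))) ∙ x₃ ⁻¹ ∙ x₄ ⁻¹                              ≈⟨ ∙-congʳ (xyx⁻¹≈y x₃ _) ⟩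
    (x₄ ∙ (a ∙ b)) ∙ x₄ ⁻¹                                            ≈⟨ xyx⁻¹≈y x₄ _ ⟩
    a ∙ b                                                             ∎

  ∑-∙ : ∀ {b} {B : Set b} (f g : B → Carrier) xs → ∑ G (map (λ x → f x ∙ g x) xs) ≈ ∑ G (map f xs) ∙ ∑ G (map g xs)
  ∑-∙ f g []       = ≈-sym (identityˡ ε)
  ∑-∙ f g (x ∷ xs) = begin
    f x ∙ g x ∙ ∑ G (map (λ x → f x ∙ g x) xs)          ≈⟨ ∙-congˡ (∑-∙ f g xs) ⟩
    f x ∙ g x ∙ (∑ G (map f xs) ∙ ∑ G (map g xs))       ≈⟨ assoc _ _ _ ⟩
    f x ∙ (g x ∙ (∑ G (map f xs) ∙ ∑ G (map g xs)))     ≈⟨ ∙-congˡ (x∙yz≈y∙xz _ _ _) ⟩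
    f x ∙ (∑ G (map f xs) ∙ (g x ∙ ∑ G (map g xs)))     ≈⟨ assoc _ _ _ ⟨
    f x ∙ ∑ G (map f xs) ∙ (g x ∙ ∑ G (map g xs))       ∎

  utilityUpTo : List Carrier → ℕ → Carrier
  utilityUpTo ws k = ∑ G (take k ws)

  take-+ : ∀ {a} {A : Set a} k m (xs : List A) → take (k + m) xs ≡ take k xs ++ slice xs k m
  take-+ zero    m xs       = refl
  take-+ (suc k) zero []    = refl
  take-+ (suc k) (suc m) [] = refl
  take-+ (suc k) m (x ∷ xs) = cong (x ∷_) (take-+ k m xs)

  ∑-slice : ∀ ws k m → ∑ G (slice ws k m) ≈ utilityUpTo ws (k + m) ∙ utilityUpTo ws k ⁻¹
  ∑-slice ws k m = ≈-sym (≈-trans (∙-congʳ (≈-trans (≈-reflexive (cong (∑ G) (take-+ k m ws)))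
    (Summation.∑-++ G (take k ws) (slice ws k m)))) (xyx⁻¹≈y _ _))

-- Matches listed by their starts and by their ends

filter-map : ∀ {p} {P : Pred ℕ p} (P? : Decidable P) (f : ℕ → ℕ) xs →
             filter P? (map f xs) ≡ map f (filter (λ x → P? (f x)) xs)
filter-map P? f []       = refl
filter-map P? f (x ∷ xs) with P? (f x)
... | yes _ = cong (f x ∷_) (filter-map P? f xs)
... | no  _ = filter-map P? f xs

applyUpTo-+ : ∀ {a} {A : Set a} (f : ℕ → A) k l → applyUpTo f (k + l) ≡ applyUpTo f k ++ applyUpTo (f ∘ (k +_)) l
applyUpTo-+ f zero    l = refl
applyUpTo-+ f (suc k) l = cong (f 0 ∷_) (applyUpTo-+ (f ∘ suc) k l)

-- Positions s + x of matches ending s later correspond to positions x of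
-- matches, neither of which run over the ends of the text.
filter-shift : ∀ {p q} {P : Pred ℕ p} {Q : Pred ℕ q} (P? : Decidable P) (Q? : Decidable Q) s n →
  (∀ {x} → x < s → ¬ P x) → (∀ {x} → n ≤ s + x → ¬ Q x) →
  (∀ {x} → P (s + x) → Q x) → (∀ {x} → Q x → P (s + x)) →
  s ≤ n → filter P? (upTo n) ≡ map (s +_) (filter Q? (upTo n))
filter-shift {P = P} {Q} P? Q? s n early late P⇒Q Q⇒P s≤n = begin
  filter P? (upTo n)                                       ≡⟨ cong (filter P? ∘ upTo) (m+[n∸m]≡n s≤n) ⟨
  filter P? (upTo (s + l))                                 ≡⟨ cong (filter P?) (applyUpTo-+ id s l) ⟩
  filter P? (upTo s ++ applyUpTo (s +_) l)                 ≡⟨ filter-++ P? (upTo s) _ ⟩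
  filter P? (upTo s) ++ filter P? (applyUpTo (s +_) l)     ≡⟨ cong (_++ filter P? (applyUpTo (s +_) l))
                                                                   (filter-none P? (applyUpTo⁺₁ id s early)) ⟩
  filter P? (applyUpTo (s +_) l)                           ≡⟨ cong (filter P?) (map-upTo (s +_) l) ⟨
  filter P? (map (s +_) (upTo l))                          ≡⟨ filter-map P? (s +_) (upTo l) ⟩
  map (s +_) (filter (λ x → P? (s + x)) (upTo l))          ≡⟨ cong (map (s +_)) (filter-≐ (λ x → P? (s + x)) Q? (P⇒Q , Q⇒P) (upTo l)) ⟩
  map (s +_) (filter Q? (upTo l))                          ≡⟨ cong (map (s +_)) (++-identityʳ _) ⟨
  map (s +_) (filter Q? (upTo l) ++ [])                    ≡⟨ cong (λ ys → map (s +_) (filter Q? (upTo l) ++ ys))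
                                                                   (filter-none Q? (applyUpTo⁺₁ (l +_) s (λ {x} _ → late (past x)))) ⟨
  map (s +_) (filter Q? (upTo l) ++ filter Q? (applyUpTo (l +_) s))  ≡⟨ cong (map (s +_)) (filter-++ Q? (upTo l) _) ⟨
  map (s +_) (filter Q? (upTo l ++ applyUpTo (l +_) s))    ≡⟨ cong (map (s +_) ∘ filter Q?) (applyUpTo-+ id l s) ⟨
  map (s +_) (filter Q? (upTo (l + s)))                    ≡⟨ cong (λ k → map (s +_) (filter Q? (upTo k))) (m∸n+n≡m s≤n) ⟩
  map (s +_) (filter Q? (upTo n))                          ∎
  where
  open ≡-Reasoning
  l : ℕ
  l = n ∸ s
  past : ∀ x → n ≤ s + (l + x)
  past x = ≤-trans (≤-reflexive (sym (m+[n∸m]≡n s≤n))) (+-monoʳ-≤ s (m≤m+n l x))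

-- The text as digits, read forwards and backwards

module Text {a} {A : Set a} (_≟ᴬ_ : DecidableEquality A) (L : List A) (n : ℕ) (len : length L ≡ n) where

  at : List A → ℕ → Maybe A
  at []       k       = nothing
  at (x ∷ xs) zero    = just x
  at (x ∷ xs) (suc k) = at xs k

  at-drop : ∀ i xs k → at (drop i xs) k ≡ at xs (i + k)
  at-drop zero    xs       k = refl
  at-drop (suc i) []       k = refl
  at-drop (suc i) (x ∷ xs) k = at-drop i xs k

  at-< : ∀ xs {k} → k < length xs → ∃[ x ] at xs k ≡ just x
  at-< (x ∷ xs) {zero}  _        = x , refl
  at-< (x ∷ xs) {suc k} (s≤s k<) = at-< xs k<

  at-≥ : ∀ xs {k} → length xs ≤ k → at xs k ≡ nothing
  at-≥ []       _        = refl
  at-≥ (x ∷ xs) (s≤s ≤k) = at-≥ xs ≤k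

  take-ext : ∀ m xs ys → (∀ {k} → k < m → at xs k ≡ at ys k) → take m xs ≡ take m ys
  take-ext zero    _        _        h = refl
  take-ext (suc m) []       []       h = refl
  take-ext (suc m) []       (y ∷ ys) h = contradiction (h {0} (s≤s z≤n)) λ ()
  take-ext (suc m) (x ∷ xs) []       h = contradiction (h {0} (s≤s z≤n)) λ ()
  take-ext (suc m) (x ∷ xs) (y ∷ ys) h = cong₂ _∷_ (just-injective (h {0} (s≤s z≤n))) (take-ext m xs ys (h ∘ s≤s))

  take-at : ∀ m xs ys → take m xs ≡ take m ys → ∀ {k} → k < m → at xs k ≡ at ys k
  take-at (suc m) []       []       e≡ _ = refl
  take-at (suc m) (x ∷ xs) (y ∷ ys) e≡ {zero}  _ = cong just (proj₁ (∷-injective e≡))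
  take-at (suc m) (x ∷ xs) (y ∷ ys) e≡ {suc k} (s≤s k<m) = take-at m xs ys (proj₂ (∷-injective e≡)) k<m

  firstIndex : List A → A → ℕ
  firstIndex []       y = 0
  firstIndex (x ∷ xs) y with x ≟ᴬ y
  ... | yes _ = 0
  ... | no  _ = suc (firstIndex xs y)

  firstIndex-≤ : ∀ xs y → firstIndex xs y ≤ length xs
  firstIndex-≤ []       y = z≤n
  firstIndex-≤ (x ∷ xs) y with x ≟ᴬ y
  ... | yes _ = z≤n
  ... | no  _ = s≤s (firstIndex-≤ xs y)

  at-firstIndex : ∀ xs {y} k → at xs k ≡ just y → at xs (firstIndex xs y) ≡ just y
  at-firstIndex (x ∷ xs) {y} k e≡ with x ≟ᴬ y
  at-firstIndex (x ∷ xs) {y} k       e≡ | yes x≡y = cong just x≡y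
  at-firstIndex (x ∷ xs) {y} zero    e≡ | no x≢y  = contradiction (just-injective e≡) x≢y
  at-firstIndex (x ∷ xs) {y} (suc k) e≡ | no _    = at-firstIndex xs k e≡

  -- Letters are numbered by their first position in the text; 0 stands for
  -- the absence of a letter.
  digit : Maybe A → ℕ
  digit nothing  = 0
  digit (just x) = suc (firstIndex L x)

  base : ℕ
  base = 2 + n

  digit-< : ∀ x → digit x < base
  digit-< nothing  = s≤s z≤n
  digit-< (just x) = s≤s (s≤s (subst (firstIndex L x ≤_) len (firstIndex-≤ L x)))

  -- Stated for entries of the text only: `firstIndex` gives all letters that do not occur in it the
  -- same number.
  digit-injective : ∀ k l → digit (at L k) ≡ digit (at L l) → at L k ≡ at L l
  digit-injective k l e≡ with at L k in eqₖ | at L l in eqₗ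
  ... | nothing | nothing = refl
  ... | just x  | just y  = trans (sym (at-firstIndex L k eqₖ)) (trans (cong (at L) (suc-injective e≡)) (at-firstIndex L l eqₗ))

  -- Both words continue with 0 past the end of the text. `bwd` needs an explicit test, as truncated
  -- subtraction would read the first letter over and over.
  fwd bwd : ℕ → ℕ → ℕ
  fwd x k = digit (at L (x + k))
  bwd x k = if k ≤ᵇ x then digit (at L (x ∸ k)) else 0

  bwd-< : ∀ x k → bwd x k < base
  bwd-< x k with k ≤ᵇ x
  ... | true  = digit-< _
  ... | false = s≤s z≤n

  module Fwd = Positional base fwd (λ x k → digit-< _)
  module Bwd = Positional base bwd bwd-<

  key⇒slice : ∀ m {x i} → Fwd.key m x ≡ Fwd.key m i → slice L x m ≡ slice L i m
  key⇒slice m {x} {i} e≡ = take-ext m _ _ λ {k} k<m →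
    trans (at-drop x L k) (trans (digit-injective (x + k) (i + k) (Fwd.key⇒digits e≡ k<m)) (sym (at-drop i L k)))

  slice⇒key : ∀ m {x i} → slice L x m ≡ slice L i m → Fwd.key m x ≡ Fwd.key m i
  slice⇒key m {x} {i} e≡ = Fwd.digits⇒key m λ {k} k<m →
    cong digit (trans (sym (at-drop x L k)) (trans (take-at m _ _ e≡ k<m) (at-drop i L k)))

  bwd-fwd : ∀ {s x k} → k ≤ s → bwd (s + x) k ≡ fwd x (s ∸ k)
  bwd-fwd {s} {x} {k} k≤s with k ≤ᵇ s + x | ≤⇒≤ᵇ (≤-trans k≤s (m≤m+n s x))
  ... | true | _ = cong (digit ∘ at L) (trans (cong (_∸ k) (+-comm s x)) (+-∸-assoc x k≤s))

  module _ {s i : ℕ} (s+i<n : s + i < n) where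

    private
      m : ℕ
      m = suc s

    bwd⇒fwd : ∀ {x} → Bwd.key m (s + x) ≡ Bwd.key m (s + i) → Fwd.key m x ≡ Fwd.key m i
    bwd⇒fwd {x} e≡ = Fwd.digits⇒key m λ {k} k<m → begin
      fwd x k                ≡⟨ cong (fwd x) (m∸[m∸n]≡n (m<1+n⇒m≤n k<m)) ⟨
      fwd x (s ∸ (s ∸ k))    ≡⟨ bwd-fwd (m∸n≤m s k) ⟨
      bwd (s + x) (s ∸ k)    ≡⟨ Bwd.key⇒digits e≡ (s≤s (m∸n≤m s k)) ⟩
      bwd (s + i) (s ∸ k)    ≡⟨ bwd-fwd (m∸n≤m s k) ⟩
      fwd i (s ∸ (s ∸ k))    ≡⟨ cong (fwd i) (m∸[m∸n]≡n (m<1+n⇒m≤n k<m)) ⟩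
      fwd i k                ∎
      where open ≡-Reasoning

    fwd⇒bwd : ∀ {x} → Fwd.key m x ≡ Fwd.key m i → Bwd.key m (s + x) ≡ Bwd.key m (s + i)
    fwd⇒bwd {x} e≡ = Bwd.digits⇒key m λ {k} k<m → trans (bwd-fwd (m<1+n⇒m≤n k<m))
      (trans (Fwd.key⇒digits e≡ (s≤s (m∸n≤m s k))) (sym (bwd-fwd (m<1+n⇒m≤n k<m))))

    private
      -- The pattern lies inside the text, so none of its digits is 0; a window that runs over an
      -- end of the text has a digit 0 and cannot match. This drives `bwd-early` and `fwd-late`.
      letter : ∀ {k} → k ≤ s → fwd i k ≢ 0
      letter {k} k≤s e≡ 
        with at-< L {i + k} (subst (i + k <_) (sym len)
               (≤-<-trans (≤-trans (+-monoʳ-≤ i k≤s) (≤-reflexive (+-comm i s))) s+i<n))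
      ... | x , at≡ = contradiction (trans (sym (cong digit at≡)) e≡) λ ()

    bwd-early : ∀ {x} → x < s → Bwd.key m x ≢ Bwd.key m (s + i)
    bwd-early {x} x<s e≡ = letter z≤n (trans (cong (fwd i) (sym (n∸n≡0 s)))
      (trans (sym (bwd-fwd {s} {i} ≤-refl)) (trans (sym (Bwd.key⇒digits {m} e≡ ≤-refl)) none)))
      where
      none : bwd x s ≡ 0
      none with s ≤ᵇ x | ≤ᵇ⇒≤ s x
      ... | true  | s≤x = contradiction (s≤x _) (<⇒≱ x<s)
      ... | false | _   = refl

    fwd-late : ∀ {x} → n ≤ s + x → Fwd.key m x ≢ Fwd.key m i
    fwd-late {x} n≤ e≡ = letter ≤-refl (trans (sym (Fwd.key⇒digits {m} e≡ ≤-refl))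
      (cong digit (at-≥ L (subst (_≤ x + s) (sym len) (≤-trans n≤ (≤-reflexive (+-comm s x)))))))

    filter-bwd : filter (λ x → Bwd.key m x ≟ Bwd.key m (s + i)) (upTo n) ≡
                 map (s +_) (filter (λ x → Fwd.key m x ≟ Fwd.key m i) (upTo n))
    filter-bwd = filter-shift _ _ s n bwd-early fwd-late bwd⇒fwd fwd⇒bwd (≤-trans (m≤m+n s i) (<⇒≤ s+i<n))

-- The query program

-- Registers during a query: 0 and 1 the query (i , j), 2 the length m,
-- 3 τ, 4 the number N of leaves, 5 m / τ, 6 m % τ, 7 to 9 the constants 1, 2
-- and 20.  Memory holds interleaved tables: entry o of table k is at 20 o + k.
address : (table idx : ℕ) → Program
address k x = setOp 21 mul x 9 ⨾ setConst 22 k ⨾ setOp 21 add 21 22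

fetch fetchU : (table dst idx : ℕ) → Program
fetch  k r x = address k x ⨾ load r 21
fetchU k r x = address k x ⨾ loadU r 21

-- Register 10 is the current node, 13 the loop flag, 14 the number of levels
-- that may still be climbed.
climbStep : ℕ → Program
climbStep c =
  fetch (8 + c) 11 10 ⨾ setOp 12 lt 11 2 ⨾
  ifNonZero 12 (setOp 10 sub 10 7 ⨾ setConst 13 0)
    (ifNonZero 14 (setOp 10 div 10 8 ⨾ setOp 14 sub 14 7)
      -- The budget is spent: entry node * τ + m % τ yields a leaf, so the descent that follows
      -- stops at its first test.
      (setOp 11 mul 10 3 ⨾ setOp 11 add 11 6 ⨾ fetch (12 + c) 10 11 ⨾ setConst 13 0))

-- The right child is tried first because the last small leaf is wanted; if its minimum is too
-- large, the step back by 1 gives the left child.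
descendStep : ℕ → Program
descendStep c =
  setOp 10 add 10 10 ⨾ setOp 10 add 10 7 ⨾ fetch (4 + c) 11 10 ⨾ setOp 12 lt 11 2 ⨾
  ifNonZero 12 skip (setOp 10 sub 10 7) ⨾ setOp 12 lt 10 4

lookupProgram : (c src : ℕ) → Program
lookupProgram c src =
  fetch c 10 src ⨾ setConst 13 1 ⨾ setConst 14 0 ⨾ setOp 14 add 14 5 ⨾
  whileNonZero 13 (climbStep c) ⨾
  setOp 12 lt 10 4 ⨾ whileNonZero 12 (descendStep c) ⨾
  fetchU c 1 10 ⨾ subU 0 0 1

prologue : Program
prologue =
  setConst 7 1 ⨾ setConst 8 2 ⨾ setConst 9 20 ⨾
  -- Register 10 is still 0, so this reads entry 0 of the tables that hold the constants τ and N.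
  fetch 16 3 10 ⨾ fetch 17 4 10 ⨾
  setOp 2 add 1 7 ⨾ setOp 2 sub 2 0 ⨾
  setOp 5 div 2 3 ⨾ setOp 6 mod 2 3 ⨾
  fetchU 4 0 10

query : Program
query = prologue ⨾ lookupProgram 0 0 ⨾ lookupProgram 1 0 ⨾ lookupProgram 2 1 ⨾ lookupProgram 3 1

-- Machine arithmetic without overflow, and table addresses

module Arithmetic (W : ℕ) where
  open WordArithmetic W

  wrap-id : ∀ {x} → x < 2 ^ W → wrap x ≡ x
  wrap-id = m<n⇒m%n≡m {{m^n≢0 2 W}}

  wrap-< : ∀ x → wrap x < 2 ^ W
  wrap-< x = m%n<n x (2 ^ W) {{m^n≢0 2 W}}

  eval-sub : ∀ {x y} → x < 2 ^ W → y ≤ x → eval sub x y ≡ x ∸ y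
  eval-sub {x} {y} x< y≤x = begin
    wrap (x + (2 ^ W ∸ y))       ≡⟨ cong wrap (+-∸-assoc x (≤-trans y≤x (<⇒≤ x<))) ⟨
    wrap (x + 2 ^ W ∸ y)         ≡⟨ cong wrap (+-∸-comm (2 ^ W) y≤x) ⟩
    wrap (x ∸ y + 2 ^ W)         ≡⟨ [m+n]%n≡m%n (x ∸ y) (2 ^ W) {{m^n≢0 2 W}} ⟩
    wrap (x ∸ y)                 ≡⟨ wrap-id (≤-<-trans (m∸n≤m x y) x<) ⟩
    x ∸ y                        ∎
    where open ≡-Reasoning

  eval-div : ∀ x y {{_ : NonZero y}} → eval div x y ≡ x / y
  eval-div x (suc y) = refl

  eval-mod : ∀ x y {{_ : NonZero y}} → eval mod x y ≡ x % y
  eval-mod x (suc y) = refl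

  lt-true : ∀ {x y} → x < y → eval lt x y ≡ 1
  lt-true {x} {y} x<y with x <ᵇ y | <⇒<ᵇ x<y
  ... | true | _ = refl

  lt-false : ∀ {x y} → y ≤ x → eval lt x y ≡ 0
  lt-false {x} {y} y≤x with x <ᵇ y | <ᵇ⇒< x y
  ... | false | _   = refl
  ... | true  | x<y = contradiction (x<y _) (≤⇒≯ y≤x)

address-< : ∀ {X o k} → o < X → k < 20 → o * 20 + k < X * 20
address-< {X} {o} {k} o<X k<20 =
  <-≤-trans (+-monoʳ-< (o * 20) k<20) (≤-trans (≤-reflexive (+-comm (o * 20) 20)) (*-monoˡ-≤ 20 o<X))

address-% : ∀ o {k} → k < 20 → (o * 20 + k) % 20 ≡ k
address-% o {k} k<20 = trans (cong (_% 20) (+-comm (o * 20) k)) (trans ([m+kn]%n≡m%n k o 20) (m<n⇒m%n≡m k<20))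

address-/ : ∀ o {k} → k < 20 → (o * 20 + k) / 20 ≡ o
address-/ o {k} k<20 = *-cancelʳ-≡ _ o 20 (+-cancelˡ-≡ k _ _ (begin
  k + (o * 20 + k) / 20 * 20                     ≡⟨ cong (_+ (o * 20 + k) / 20 * 20) (address-% o k<20) ⟨
  (o * 20 + k) % 20 + (o * 20 + k) / 20 * 20     ≡⟨ m≡m%n+[m/n]*n (o * 20 + k) 20 ⟨
  o * 20 + k                                     ≡⟨ +-comm (o * 20) k ⟩
  k + o * 20                                     ∎))
  where open ≡-Reasoning

-- A level costs at most 11 steps in either direction, and the last round of the climb, with its
-- table access and the loop exit, at most 16. The 7, 1 and 5 are the instructions before, between
-- and after the loops.
lookup-time : ∀ b {t₁ t₂} → t₁ ≤ b * 11 + 16 → t₂ ≤ 1 + b * 11 → 7 + (t₁ + (1 + (t₂ + 5))) ≤ 30 + b * 22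
lookup-time b t₁≤ t₂≤ = +-monoʳ-≤ 7 (≤-trans (+-mono-≤ t₁≤ (+-monoʳ-≤ 1 (+-monoˡ-≤ 5 t₂≤))) (≤-reflexive (total b)))
  where
  total : ∀ b → b * 11 + 16 + (1 + (1 + b * 11 + 5)) ≡ 23 + b * 22
  total = solve-∀

-- Running programs on interleaved read-only tables

module TableMachine {a ℓ} (G : AbelianGroup a ℓ) (W X : ℕ) (X*20< : X * 20 < 2 ^ W) (2≤X : 2 ≤ X)
  (table : ℕ → ℕ → ℕ) (tableU : ℕ → ℕ → AbelianGroup.Carrier G) where

  open AbelianGroup G using (Carrier; _≈_; _∙_; ε; _⁻¹) renaming (refl to ≈-refl)
  open WordArithmetic W
  open Arithmetic W
  open WordRAM G W

  -- Wrapping makes every cell fit a word unconditionally; a bound on an entry has to be proved only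
  -- where `fetchStep` reads it.
  contents : ℕ → ℕ
  contents a = wrap (table (a % 20) (a / 20))

  contentsU : ℕ → Carrier
  contentsU a = tableU (a % 20) (a / 20)

  memory : Memory
  memory = record
    { wordCells = X * 20 ; utilCells = X * 20
    ; words = λ k → contents (toℕ k) ; utils = λ k → contentsU (toℕ k)
    ; fits = λ k → wrap-< _ }

  Exec : Program → (Reg → ℕ) → (Reg → Carrier) → (Reg → ℕ) → (Reg → Carrier) → ℕ → Set a
  Exec p ρ υ ρ′ υ′ t =
    ⟨ p , state ρ υ (Memory.words memory) (Memory.utils memory) ⟩⇓
      state ρ′ υ′ (Memory.words memory) (Memory.utils memory) [ t ]

  <X⇒<word : ∀ {x} → x < X → x < 2 ^ W
  <X⇒<word x< = <-trans (≤-<-trans (m≤m*n _ 20) (*-monoˡ-< 20 x<)) X*20<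

  20<word : 20 < 2 ^ W
  20<word = ≤-<-trans (*-monoˡ-≤ 20 (≤-trans (s≤s z≤n) 2≤X)) X*20<

  fetched : (Reg → ℕ) → ℕ → ℕ → Reg → ℕ
  fetched ρ k o = ((ρ [ 21 ↦ o * 20 ]) [ 22 ↦ k ]) [ 21 ↦ o * 20 + k ]

  module _ {ρ : Reg → ℕ} {υ : Reg → Carrier} where

    constStep : ∀ {d k} → k ≤ 20 → Exec (setConst d k) ρ υ (ρ [ d ↦ k ]) υ 1
    constStep {d} {k} k≤ = subst (λ v → Exec (setConst d k) ρ υ (ρ [ d ↦ v ]) υ 1)
      (wrap-id (≤-<-trans k≤ 20<word)) ⇓const

    opStep : ∀ {d o x y v} → eval o (ρ x) (ρ y) ≡ v → Exec (setOp d o x y) ρ υ (ρ [ d ↦ v ]) υ 1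
    opStep refl = ⇓op

    module _ {d x y k l : ℕ} (ρx : ρ x ≡ k) (ρy : ρ y ≡ l) where

      addStep : k + l < 2 ^ W → Exec (setOp d add x y) ρ υ (ρ [ d ↦ k + l ]) υ 1
      addStep k+l< = opStep (trans (cong₂ (eval add) ρx ρy) (wrap-id k+l<))

      mulStep : k * l < 2 ^ W → Exec (setOp d mul x y) ρ υ (ρ [ d ↦ k * l ]) υ 1
      mulStep kl< = opStep (trans (cong₂ (eval mul) ρx ρy) (wrap-id kl<))

      subStep : k < 2 ^ W → l ≤ k → Exec (setOp d sub x y) ρ υ (ρ [ d ↦ k ∸ l ]) υ 1
      subStep k< l≤k = opStep (trans (cong₂ (eval sub) ρx ρy) (eval-sub k< l≤k))

      divStep : {{_ : NonZero l}} → Exec (setOp d div x y) ρ υ (ρ [ d ↦ k / l ]) υ 1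
      divStep = opStep (trans (cong₂ (eval div) ρx ρy) (eval-div k l))

      modStep : {{_ : NonZero l}} → Exec (setOp d mod x y) ρ υ (ρ [ d ↦ k % l ]) υ 1
      modStep = opStep (trans (cong₂ (eval mod) ρx ρy) (eval-mod k l))

      ltStep : Exec (setOp d lt x y) ρ υ (ρ [ d ↦ eval lt k l ]) υ 1
      ltStep = opStep (cong₂ (eval lt) ρx ρy)

  module _ {k x o : ℕ} {ρ : Reg → ℕ} {υ : Reg → Carrier} (ρx : ρ x ≡ o) (ρ9 : ρ 9 ≡ 20) (k<20 : k < 20) (o<X : o < X) where

    private
      addr< : o * 20 + k < X * 20
      addr< = address-< o<X k<20

      o*20< : o * 20 < 2 ^ W
      o*20< = ≤-<-trans (m≤m+n (o * 20) k) (<-trans addr< X*20<)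

      addressSteps : Exec (address k x) ρ υ (fetched ρ k o) υ 3
      addressSteps =
        ⇓seq (mulStep ρx ρ9 o*20<)
        (⇓seq (constStep (<⇒≤ k<20)) (addStep refl refl (<-trans addr< X*20<)))

    fetchStep : ∀ {r v} → table k o ≡ v → v < 2 ^ W →
                Exec (fetch k r x) ρ υ (fetched ρ k o [ r ↦ v ]) υ 4
    fetchStep {r} {v} entry v< = loading addressSteps
      (subst (λ w → Exec (load r 21) (fetched ρ k o) υ (fetched ρ k o [ r ↦ w ]) υ 1)
         (trans (cong contents (toℕ-fromℕ< addr<))
         (trans (cong₂ (λ a b → wrap (table a b)) (address-% o k<20) (address-/ o k<20))
         (trans (cong wrap entry) (wrap-id v<))))
         (⇓load addr<))
      where
      loading : ∀ {p q ρ₁ υ₁ ρ₂ υ₂} → Exec p ρ υ ρ₁ υ₁ 3 → Exec q ρ₁ υ₁ ρ₂ υ₂ 1 → Exec (p ⨾ q) ρ υ ρ₂ υ₂ 4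
      loading = ⇓seq

    fetchUStep : ∀ {r} → Exec (fetchU k r x) ρ υ (fetched ρ k o) (υ [ r ↦ tableU k o ]) 4
    fetchUStep {r} = ⇓seq addressSteps
      (subst (λ w → Exec (loadU r 21) (fetched ρ k o) υ (fetched ρ k o) (υ [ r ↦ w ]) 1)
         (trans (cong contentsU (toℕ-fromℕ< addr<)) (cong₂ tableU (address-% o k<20) (address-/ o k<20)))
         (⇓loadU addr<))

  -- Correctness and running time of the lookups

  module Query (K n i j m τ b r : ℕ) {{_ : NonZero τ}} where

    Env : (Reg → ℕ) → Set
    Env ρ = ρ 0 ≡ i × ρ 1 ≡ j × ρ 2 ≡ m × ρ 3 ≡ τ × ρ 4 ≡ 2 ^ K × ρ 5 ≡ b × ρ 6 ≡ r
          × ρ 7 ≡ 1 × ρ 8 ≡ 2 × ρ 9 ≡ 20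

    start : Reg → ℕ
    start = (const 0 [ 0 ↦ i ]) [ 1 ↦ j ]

    record Outcome {q} (p : Program) (bound : ℕ) (ρ : Reg → ℕ) (υ : Reg → Carrier)
                   (Post : (Reg → ℕ) → (Reg → Carrier) → Set q) : Set (a ⊔ q) where
      constructor result
      field
        {regs}  : Reg → ℕ
        {uregs} : Reg → Carrier
        {time}  : ℕ
        run     : Exec p ρ υ regs uregs time
        timely  : time ≤ bound
        env     : Env regs
        post    : Post regs uregs

    infixr 5 _then_

    _then_ : ∀ {q q′ p p′ t t′ ρ υ} {Post : (Reg → ℕ) → (Reg → Carrier) → Set q}
      {Post′ : (Reg → ℕ) → (Reg → Carrier) → Set q′} → Outcome p t ρ υ Post →
      (∀ {ρ υ} → Env ρ → Post ρ υ → Outcome p′ t′ ρ υ Post′) → Outcome (p ⨾ p′) (t + t′) ρ υ Post′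
    result run timely env post then next with next env post
    ... | result run′ timely′ env′ post′ = result (⇓seq run run′) (+-mono-≤ timely timely′) env′ post′

    weaken : ∀ {q q′ p t ρ υ} {Post : (Reg → ℕ) → (Reg → Carrier) → Set q}
      {Post′ : (Reg → ℕ) → (Reg → Carrier) → Set q′} → (∀ ρ υ → Post ρ υ → Post′ ρ υ) →
      Outcome p t ρ υ Post → Outcome p t ρ υ Post′
    weaken f (result run timely env post) = result run timely env (f _ _ post)

    outcome⇒answers : ∀ {p t v} → Outcome p t start (const ε) (λ _ υ → υ 0 ≈ v) →
      Σ[ t′ ∈ ℕ ] t′ ≤ t × Answers p memory i j v t′
    outcome⇒answers (result run timely _ post) = _ , timely , _ , run , post , (λ _ → refl) , (λ _ → ≈-refl)

    module _ (i≤j : i ≤ j) (j+1< : j + 1 < 2 ^ W) (τ< : τ < 2 ^ W) (N< : 2 ^ K < 2 ^ W)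
      (m≡ : m ≡ j + 1 ∸ i) (b≡ : b ≡ m / τ) (r≡ : r ≡ m % τ)
      (table-τ : table 16 0 ≡ τ) (table-N : table 17 0 ≡ 2 ^ K) where

      prologueSteps : ∀ {υ} → Outcome prologue 19 start υ (λ _ υ′ → υ′ 0 ≡ tableU 4 0)
      prologueSteps = result
        (⇓seq (constStep (s≤s z≤n)) (⇓seq (constStep (s≤s (s≤s z≤n))) (⇓seq (constStep ≤-refl)
        (⇓seq (fetchStep {o = 0} refl refl (m≤m+n 17 3) 0<X table-τ τ<)
        (⇓seq (fetchStep {o = 0} refl refl (m≤m+n 18 2) 0<X table-N N<)
        (⇓seq (addStep {k = j} {l = 1} refl refl j+1<)
        (⇓seq (subStep {k = j + 1} {l = i} refl refl j+1< (≤-trans i≤j (m≤m+n j 1)))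
        (⇓seq (divStep {k = j + 1 ∸ i} {l = τ} refl refl)
        (⇓seq (modStep {k = j + 1 ∸ i} {l = τ} refl refl)
              (fetchUStep {o = 0} refl refl (m≤m+n 5 15) 0<X))))))))))
        ≤-refl
        (refl , refl , sym m≡ , refl , refl , sym (trans b≡ (cong (_/ τ) m≡))
        , sym (trans r≡ (cong (_% τ) m≡)) , refl , refl , refl)
        refl
        where
        0<X : 0 < X
        0<X = <-trans (s≤s z≤n) 2≤X

    -- z is the leaf after that of the queried position pos, so that the leaf
    -- sought is the last one before z with H below m.
    module Lookup
      (heap-fits : 2 ^ K + 2 ^ K ≤ X) (τ-fits : (2 ^ K + 2 ^ K) * τ ≤ X) (n<X : n < X)
      (1≤m : 1 ≤ m) (m≤n : m ≤ n) (m≡ : m ≡ b * τ + r) (r<τ : r < τ)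
      (H : ℕ → ℕ) (H≤n : ∀ l → H l ≤ n) (H0 : H (2 ^ K) ≡ 0)
      (c src pos z : ℕ) (c<4 : c < 4)
      (srcValue : ∀ ρ → Env ρ → ρ src ≡ pos) (pos<X : pos < X)
      (N<z : 2 ^ K < z) (z<2N : z < 2 ^ K + 2 ^ K)
      (startEntry : table c pos ≡ z)
      (minEntry : ∀ o → table (4 + c) o ≡ Tree.minAt K H (Tree.height K H K o) o)
      (siblingEntry : ∀ o → table (8 + c) o ≡
        (if o % 2 ≡ᵇ 0 then n else Tree.minAt K H (Tree.height K H K o) (o ∸ 1)))
      (lastEntry : ∀ o → table (12 + c) o ≡
        Tree.lastBelow K H (Tree.height K H K (o / τ) * τ + o % τ) (o / τ * 2 ^ Tree.height K H K (o / τ)))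
      where

      open Tree K H

      n<word : n < 2 ^ W
      n<word = <X⇒<word n<X

      2N⇒<X : ∀ {x} → x < N + N → x < X
      2N⇒<X x< = <-≤-trans x< heap-fits

      descend : ∀ e {y ρ υ} → Env ρ → ρ 10 ≡ y → ρ 12 ≡ eval lt y N → Found m z e y →
                Outcome (whileNonZero 12 (descendStep c)) (1 + e * 11) ρ υ
                  (λ ρ′ υ′ → υ′ ≡ υ × IsLast m z (ρ′ 10))
      descend zero ev refl ρ12 f =
        result (⇓stop (trans ρ12 (lt-false (IsLast.leaf (found⇒isLast f))))) ≤-refl ev (refl , found⇒isLast f)
      descend (suc e) {y} {ρ} {υ} ev@(_ , _ , ρ2 , _ , ρ4 , _ , _ , ρ7 , _ , ρ9) ρ10 ρ12 f
        = go (minAt e (suc (y + y)) <? m)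
        where
        inner : ρ 12 ≢ 0
        inner ρ12≡0 = contradiction (trans (sym (trans ρ12 (lt-true (found-inner f)))) ρ12≡0) λ ()

        child< : y + y + 1 < N + N
        child< = ≤-trans (≤-reflexive (trans (cong suc (+-comm (y + y) 1)) (cong suc (sym (+-suc y y)))))
          (+-mono-≤ (found-inner f) (found-inner f))

        child<word : y + y + 1 < 2 ^ W
        child<word = <X⇒<word (2N⇒<X child<)

        childMin : table (4 + c) (y + y + 1) ≡ minAt e (suc (y + y))
        childMin = trans (minEntry (y + y + 1)) (trans (cong (λ x → minAt (height K x) x) (+-comm (y + y) 1))
          (cong (λ h → minAt h (suc (y + y)))
            (height-node e K (m+n≤o⇒n≤o (suc depth) (≤-reflexive eqʰ)) (childʳ node) eqʰ)))
          where
          open Found f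
          eqʰ : suc depth + e ≡ K
          eqʰ = trans (sym (+-suc depth e)) heightʸ

        prefix : ∀ {ρ′ υ′ q t} →
          Exec q (fetched ((ρ [ 10 ↦ y + y ]) [ 10 ↦ y + y + 1 ]) (4 + c) (y + y + 1) [ 11 ↦ minAt e (suc (y + y)) ]
                   [ 12 ↦ eval lt (minAt e (suc (y + y))) m ]) υ ρ′ υ′ t →
          Exec (setOp 10 add 10 10 ⨾ setOp 10 add 10 7 ⨾ fetch (4 + c) 11 10 ⨾ setOp 12 lt 11 2 ⨾ q) ρ υ ρ′ υ′ (7 + t)
        prefix rest =
          ⇓seq (addStep ρ10 ρ10 (≤-<-trans (m≤m+n (y + y) 1) child<word))
          (⇓seq (addStep refl ρ7 child<word)
          (⇓seq (fetchStep refl ρ9 (≤-trans (+-monoʳ-< 4 c<4) (m≤m+n 8 12)) (2N⇒<X child<) childMin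
                   (≤-<-trans (minAt-≤ H≤n e _) n<word))
          (⇓seq (ltStep refl ρ2) rest)))

        go : Dec (minAt e (suc (y + y)) < m) → Outcome (whileNonZero 12 (descendStep c)) (1 + suc e * 11) ρ υ
               (λ ρ′ υ′ → υ′ ≡ υ × IsLast m z (ρ′ 10))
        go (yes below) =
          let res = descend e {y + y + 1} {υ = υ} ev refl refl (subst (Found m z e) (+-comm 1 (y + y)) (foundʳ f below))
              open Outcome res
          in result
            (⇓loop inner (prefix (⇓seq
              (⇓then (λ p → contradiction (trans (sym (lt-true below)) p) λ ()) ⇓skip)
              (ltStep refl ρ4))) run)
            (s≤s (≤-trans (+-monoʳ-≤ 9 timely) (n≤1+n _))) env post
        go (no ≮m) =
          let res = descend e {y + y + 1 ∸ 1} {υ = υ} ev refl refl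
                      (subst (Found m z e) (sym (m+n∸n≡m (y + y) 1)) (foundˡ f (≮⇒≥ ≮m)))
              open Outcome res
          in result
            (⇓loop inner (prefix (⇓seq
              (⇓else (lt-false (≮⇒≥ ≮m)) (subStep {k = y + y + 1} refl ρ7 child<word (m≤n+m 1 (y + y))))
              (ltStep refl ρ4))) run)
            (s≤s (+-monoʳ-≤ 10 timely)) env post

      -- Levels climbed and levels left always add up to `b`, so when none are left the height is
      -- `b` and the table entry is the one for `m`.
      climb : ∀ k {e x ρ υ} → Env ρ → ρ 10 ≡ x → ρ 13 ≡ 1 → ρ 14 ≡ k → e + k ≡ b → Frontier m z e x →
              Outcome (whileNonZero 13 (climbStep c)) (k * 11 + 16) ρ υ
                (λ ρ′ υ′ → υ′ ≡ υ × ∃[ e′ ] e′ ≤ b × Found m z e′ (ρ′ 10))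
      climb k {e} {x} {ρ} {υ} ev@(_ , _ , ρ2 , ρ3 , _ , _ , ρ6 , ρ7 , ρ8 , ρ9) ρ10 ρ13 ρ14 e+k≡b f
        = go (sibling <? m) k refl
        where
        open Frontier f using (depth; node; heightˣ)

        sibling : ℕ
        sibling = if x % 2 ≡ᵇ 0 then n else minAt e (x ∸ 1)

        heightˣ′ : height K x ≡ e
        heightˣ′ = height-node e K (m+n≤o⇒n≤o depth (≤-reflexive heightˣ)) node heightˣ

        sibling≤n : sibling ≤ n
        sibling≤n with x % 2 ≡ᵇ 0
        ... | true  = ≤-refl
        ... | false = minAt-≤ H≤n e (x ∸ 1)

        x<X : x < X
        x<X = 2N⇒<X (Frontier.inHeap f)

        x<word : x < 2 ^ W
        x<word = <X⇒<word x<X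

        1≤x : 1 ≤ x
        1≤x = ≤-trans (m^n>0 2 depth) (Node.lower node)

        sibling-below : sibling < m → x % 2 ≡ 1 × minAt e (x ∸ 1) < m
        sibling-below below with halve x
        ... | inj₁ (_ , even) = contradiction m≤n
                (<⇒≱ (subst (λ q → (if q ≡ᵇ 0 then n else minAt e (x ∸ 1)) < m) even below))
        ... | inj₂ (_ , odd)  = odd , subst (λ q → (if q ≡ᵇ 0 then n else minAt e (x ∸ 1)) < m) odd below

        sibling-clear : m ≤ sibling → x % 2 ≡ 1 → m ≤ minAt e (x ∸ 1)
        sibling-clear m≤ odd = subst (λ q → m ≤ (if q ≡ᵇ 0 then n else minAt e (x ∸ 1))) odd m≤

        nonZero13 : ρ 13 ≢ 0
        nonZero13 ρ13≡0 = contradiction (trans (sym ρ13) ρ13≡0) λ ()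

        ρ′ : Reg → ℕ
        ρ′ = fetched ρ (8 + c) x [ 11 ↦ sibling ] [ 12 ↦ eval lt sibling m ]

        prefix : ∀ {ρ″ υ″ q t} → Exec q ρ′ υ ρ″ υ″ t →
                 Exec (fetch (8 + c) 11 10 ⨾ setOp 12 lt 11 2 ⨾ q) ρ υ ρ″ υ″ (5 + t)
        prefix rest =
          ⇓seq (fetchStep ρ10 ρ9 (≤-trans (+-monoʳ-< 8 c<4) (m≤m+n 12 8)) x<X
                 (trans (siblingEntry x) (cong (λ h → if x % 2 ≡ᵇ 0 then n else minAt h (x ∸ 1)) heightˣ′))
                 (≤-<-trans sibling≤n n<word))
          (⇓seq (ltStep refl ρ2) rest)

        entry< : x * τ + r < X
        entry< = <-≤-trans (+-monoʳ-< (x * τ) r<τ)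
          (≤-trans (≤-reflexive (+-comm (x * τ) τ)) (≤-trans (*-monoˡ-≤ τ (Frontier.inHeap f)) τ-fits))

        entry/τ : (x * τ + r) / τ ≡ x
        entry/τ = trans (+-distrib-/ (x * τ) r (subst (_< τ) (sym remainders) r<τ))
          (trans (cong₂ _+_ (m*n/n≡m x τ) (m<n⇒m/n≡0 r<τ)) (+-identityʳ x))
          where
          remainders : x * τ % τ + r % τ ≡ r
          remainders = cong₂ _+_ (m*n%n≡0 x τ) (m<n⇒m%n≡m r<τ)

        entry%τ : (x * τ + r) % τ ≡ r
        entry%τ = trans (cong (_% τ) (+-comm (x * τ) r)) (trans ([m+kn]%n≡m%n r x τ) (m<n⇒m%n≡m r<τ))

        go : Dec (sibling < m) → ∀ k′ → k ≡ k′ →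
             Outcome (whileNonZero 13 (climbStep c)) (k * 11 + 16) ρ υ
                (λ ρ′ υ′ → υ′ ≡ υ × ∃[ e′ ] e′ ≤ b × Found m z e′ (ρ′ 10))
        go (yes below) _ _ = result
          (⇓loop nonZero13 (prefix (⇓then (λ p → contradiction (trans (sym (lt-true below)) p) λ ())
            (⇓seq (subStep ρ10 ρ7 x<word 1≤x) (constStep z≤n)))) (⇓stop refl))
          (≤-trans (m≤m+n 10 6) (m≤n+m 16 (k * 11))) ev
          (refl , e , m+n≤o⇒m≤o e (≤-reflexive e+k≡b)
                , frontier-found 1≤m H0 N<z f (proj₁ (sibling-below below)) (proj₂ (sibling-below below)))
        go (no ≮m) zero refl = result
          (⇓loop nonZero13 (prefix (⇓else (lt-false (≮⇒≥ ≮m)) (⇓else ρ14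
            (⇓seq (mulStep ρ10 ρ3 (≤-<-trans (m≤m+n (x * τ) r) (<X⇒<word entry<)))
            (⇓seq (addStep {k = x * τ} refl ρ6 (<X⇒<word entry<))
            (⇓seq (fetchStep {o = x * τ + r} refl ρ9 (≤-trans (+-monoʳ-< 12 c<4) (m≤m+n 16 4)) entry<
                     (trans (lastEntry (x * τ + r))
                     (trans (cong₂ (λ o q → lastBelow (height K o * τ + q) (o * 2 ^ height K o)) entry/τ entry%τ)
                     (trans (cong (λ h → lastBelow (h * τ + r) (x * 2 ^ h)) heightˣ′)
                            (cong (λ a → lastBelow a (x * 2 ^ e)) eτ+r≡m))))
                     (<X⇒<word (2N⇒<X (<-trans (IsLast.before last) z<2N))))
                  (constStep z≤n)))))))
            (⇓stop refl))
          -- The table supplies a leaf, that is, a found node of height 0, whatever height the climb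
          -- had reached.
          ≤-refl ev (refl , 0 , z≤n , isLast⇒found (<⇒≤ z<2N) last)
          where
          last : IsLast m z (lastBelow m (x * 2 ^ e))
          last = frontier-lastBelow 1≤m H0 N<z f
          eτ+r≡m : e * τ + r ≡ m
          eτ+r≡m = trans (cong (λ a → a * τ + r) (trans (sym (+-identityʳ e)) e+k≡b)) (sym m≡)
        go (no ≮m) (suc k′) refl =
          let res = climb k′ {suc e} {x / 2} {υ = υ} ev refl ρ13 refl (trans (sym (+-suc e k′)) e+k≡b)
                      (frontier-up 1≤m H0 N<z f (sibling-clear (≮⇒≥ ≮m)))
              open Outcome res
          in result
            (⇓loop nonZero13 (prefix (⇓else (lt-false (≮⇒≥ ≮m))
              (⇓then (λ p → contradiction (trans (sym ρ14) p) λ ())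
                (⇓seq (divStep ρ10 ρ8) (subStep ρ14 ρ7 (≤-<-trans (≤-trans k≤m m≤n) n<word) (s≤s z≤n)))))) run)
            (≤-trans (+-monoʳ-≤ 10 timely) (n≤1+n _)) env post
          where
          k≤m : suc k′ ≤ m
          k≤m = ≤-trans (m+n≤o⇒n≤o e (≤-reflexive e+k≡b))
            (≤-trans (m≤m*n b τ) (≤-trans (m≤m+n (b * τ) r) (≤-reflexive (sym m≡))))

      lookupSteps : ∀ {ρ υ} → Env ρ →
        Outcome (lookupProgram c src) (30 + b * 22) ρ υ
          (λ ρ′ υ′ → ∃[ l ] IsLast m z l × υ′ 0 ≡ υ 0 ∙ (tableU c l) ⁻¹)
      lookupSteps {ρ} {υ} ev@(_ , _ , _ , _ , _ , ρ5 , _ , _ , _ , ρ9)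
        with climb b {0} {z} {fetched ρ c pos [ 10 ↦ z ] [ 13 ↦ 1 ] [ 14 ↦ 0 ] [ 14 ↦ b ]} {υ}
               ev refl refl refl refl (frontier-init (<⇒≤ N<z) z<2N)
      ... | result {ρ₁} {_} {t₁} run₁ timely₁ env₁@(_ , _ , _ , _ , ρ₁4 , _) (refl , e , e≤b , found)
        with descend e {ρ₁ 10} {ρ₁ [ 12 ↦ eval lt (ρ₁ 10) N ]} {υ} env₁ refl refl found
      ... | result {ρ₂} {_} {t₂} run₂ timely₂ env₂@(_ , _ , _ , _ , _ , _ , _ , _ , _ , ρ₂9) (refl , last) = result
        (⇓seq (fetchStep (srcValue ρ ev) ρ9 c<20 pos<X startEntry (<X⇒<word (2N⇒<X z<2N)))
        (⇓seq (constStep (s≤s z≤n))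
        (⇓seq (constStep z≤n)
        (⇓seq (addStep {k = 0} refl ρ5 b<word)
        (⇓seq run₁
        (⇓seq (ltStep refl ρ₁4)
        (⇓seq run₂
        (⇓seq (fetchUStep refl ρ₂9 c<20 (2N⇒<X (<-trans (IsLast.before last) z<2N))) ⇓subU))))))))
        (lookup-time b timely₁ (≤-trans timely₂ (+-monoʳ-≤ 1 (*-monoˡ-≤ 11 e≤b)))) env₂ (ρ₂ 10 , last , refl)
        where
        c<20 : c < 20
        c<20 = ≤-trans c<4 (m≤m+n 4 16)

        b<word : b < 2 ^ W
        b<word = ≤-<-trans (≤-trans (m≤m*n b τ) (≤-trans (m≤m+n (b * τ) r) (≤-reflexive (sym m≡))))
          (≤-<-trans m≤n n<word)

-- Strictness leaves room for the leaf one past the last place, where a search may start; the upper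
-- bound keeps the heap linear in `n`.
powerAbove : ∀ n → 1 ≤ n → ∃[ K ] n < 2 ^ K × 2 ^ K ≤ n + n
powerAbove (suc zero)    _ = 1 , ≤-refl , ≤-refl
powerAbove (suc (suc n)) _ with powerAbove (suc n) (s≤s z≤n)
... | K , lo , hi with suc (suc n) <? 2 ^ K
...   | yes lo′ = K , lo′ , ≤-trans hi (+-mono-≤ (n≤1+n (suc n)) (n≤1+n (suc n)))
-- Here `2 ^ K` is exactly `2 + n`, so its double meets both bounds.
...   | no ¬lo′ = suc K , subst (2 + n <_) doubled (m<m+n (2 + n) (s≤s z≤n)) , ≤-reflexive (sym doubled)
  where
  doubled : (2 + n) + (2 + n) ≡ 2 ^ suc K
  doubled = trans (cong (λ a → a + a) (≤-antisym lo (≮⇒≥ ¬lo′))) (sym (pow-double K))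

-- The data structure

-- The prologue takes 19 steps and each lookup 30 + 22b, which gives 139 + 88b in total; multiplying
-- by τ turns bτ into at most `m`.
query-time : ∀ {t b τ m l} → t ≤ 19 + (30 + b * 22 + (30 + b * 22 + (30 + b * 22 + (30 + b * 22)))) →
  b * τ ≤ m → l ≡ m → t * τ ≤ 200 * (τ + l)
query-time {t} {b} {τ} {m} {l} t≤ bτ≤m refl = begin
  t * τ                        ≤⟨ *-monoˡ-≤ τ t≤ ⟩
  _                            ≡⟨ regroup b τ ⟩
  139 * τ + 88 * (b * τ)       ≤⟨ +-mono-≤ (*-monoˡ-≤ τ (m≤m+n 139 61)) (*-mono-≤ (m≤m+n 88 112) bτ≤m) ⟩
  200 * τ + 200 * m            ≡⟨ *-distribˡ-+ 200 τ m ⟨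
  200 * (τ + m)                ∎
  where
  open ≤-Reasoning
  regroup : ∀ b τ → (19 + (30 + b * 22 + (30 + b * 22 + (30 + b * 22 + (30 + b * 22))))) * τ ≡ 139 * τ + 88 * (b * τ)
  regroup = solve-∀

module Construction {a c ℓ} {A : Set a} (_≟ᴬ_ : DecidableEquality A) (G : AbelianGroup c ℓ)
  (n : ℕ) (T : Vector A n) (w : Vector (AbelianGroup.Carrier G) n)
  (τ : ℕ) {{_ : NonZero τ}} (1≤n : 1 ≤ n) (τ≤n : τ ≤ n)
  (K : ℕ) (n<N : n < 2 ^ K) (X : ℕ) (2Nτ≤X : (2 ^ K + 2 ^ K) * τ ≤ X) (W : ℕ) (X*20< : X * 20 < 2 ^ W) where

  open AbelianGroup G renaming (refl to ≈-refl; sym to ≈-sym; trans to ≈-trans; 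
    reflexive to ≈-reflexive; setoid to ≈-setoid)
  open Summation G

  open Text _≟ᴬ_ (toList T) n (length-tabulate T)

  N : ℕ
  N = 2 ^ K

  2N≤X : N + N ≤ X
  2N≤X = ≤-trans (m≤m*n (N + N) τ) 2Nτ≤X

  n<X : n < X
  n<X = <-≤-trans n<N (≤-trans (m≤m+n N N) 2N≤X)

  2≤X : 2 ≤ X
  2≤X = ≤-trans (s≤s 1≤n) n<X

  -- Tables 0 to 3 order the suffixes and the reversed prefixes, each in
  -- increasing and in decreasing order.
  keys : ℕ → ℕ → ℕ → ℕ
  keys 0 = Fwd.key
  keys 1 = Fwd.cokey
  keys 2 = Bwd.key
  keys _ = Bwd.cokey

  keys-coherent : ∀ c m x y → keys c (suc m) x ≤ keys c (suc m) y → keys c m x ≤ keys c m y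
  keys-coherent 0 = Fwd.key-coherent
  keys-coherent 1 = Fwd.cokey-coherent
  keys-coherent 2 = Bwd.key-coherent
  keys-coherent (suc (suc (suc _))) = Bwd.cokey-coherent

  module Order (c : ℕ) = KeyOrder n (keys c) (keys-coherent c)

  S : ℕ → Carrier
  S = utilityUpTo G (toList w)

  starts ends : ℕ → Carrier
  starts x = S x ⁻¹
  ends   x = S (suc x)

  weights : ℕ → ℕ → Carrier
  weights 0 = starts
  weights 1 = starts
  weights _ = ends

  H : ℕ → ℕ → ℕ
  H c = Order.lcpLeaf c K

  height : ℕ → ℕ → ℕ
  height c = Tree.height K (H c) K

  minAt : ℕ → ℕ → ℕ → ℕ
  minAt c = Tree.minAt K (H c)

  -- The sibling table holds n, which is never below m, where there is no left
  -- sibling.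
  tableOf : ℕ → ℕ → ℕ → ℕ
  tableOf 0 c o = N + suc (Order.rank c o)
  tableOf 1 c o = minAt c (height c o) o
  tableOf 2 c o = if o % 2 ≡ᵇ 0 then n else minAt c (height c o) (o ∸ 1)
  tableOf 3 c o = Tree.lastBelow K (H c) (height c (o / τ) * τ + o % τ) (o / τ * 2 ^ height c (o / τ))
  tableOf _ 0 o = τ
  tableOf _ _ o = N

  table : ℕ → ℕ → ℕ
  table k = tableOf (k / 4) (k % 4)

  total : Carrier
  total = ∑ G (map starts (upTo n)) ∙ ∑ G (map ends (upTo n))

  tableU : ℕ → ℕ → Carrier
  tableU 4 o = total
  tableU c o = Order.prefixSum c G (weights c) (o ∸ N)

  -- The quotient and remainder by 4 compute only once `c` is a literal, hence the four identical
  -- cases.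
  table-kind : ∀ c → c < 4 → (∀ o → table c o ≡ tableOf 0 c o) × (∀ o → table (4 + c) o ≡ tableOf 1 c o)
    × (∀ o → table (8 + c) o ≡ tableOf 2 c o) × (∀ o → table (12 + c) o ≡ tableOf 3 c o)
    × (∀ o → tableU c o ≡ Order.prefixSum c G (weights c) (o ∸ N))
  table-kind 0 _ = (λ o → refl) , (λ o → refl) , (λ o → refl) , (λ o → refl) , (λ o → refl)
  table-kind 1 _ = (λ o → refl) , (λ o → refl) , (λ o → refl) , (λ o → refl) , (λ o → refl)
  table-kind 2 _ = (λ o → refl) , (λ o → refl) , (λ o → refl) , (λ o → refl) , (λ o → refl)
  table-kind 3 _ = (λ o → refl) , (λ o → refl) , (λ o → refl) , (λ o → refl) , (λ o → refl)
  table-kind (suc (suc (suc (suc _)))) (s≤s (s≤s (s≤s (s≤s ()))))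

  open TableMachine G W X X*20< 2≤X table tableU public
  open WordRAM G W using (Answers)

  belowSum : ℕ → ℕ → ℕ → Carrier
  belowSum c m pos = ∑ G (map (weights c) (filter (λ x → keys c m x <? keys c m pos) (upTo n)))

  module _ (i j : ℕ) (i≤j : i ≤ j) (j<n : j < n) where

    m b : ℕ
    m = suc (j ∸ i)
    b = m / τ

    open Query K n i j m τ b (m % τ)

    m≤n : m ≤ n
    m≤n = ≤-trans (s≤s (m∸n≤m j i)) j<n

    lookupStep : ∀ c src pos → c < 4 → pos < n → (∀ ρ → Env ρ → ρ src ≡ pos) → ∀ {v ρ υ} → Env ρ → υ 0 ≈ v →
      Outcome (lookupProgram c src) (30 + b * 22) ρ υ (λ _ υ′ → υ′ 0 ≈ v ∙ belowSum c m pos ⁻¹)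
    lookupStep c src pos c<4 pos<n srcValue {v} {υ = υ} env υ0≈v with table-kind c c<4
    ... | starts≡ , mins≡ , siblings≡ , lasts≡ , sums≡ = weaken (λ _ υ′ → subtracted υ′)
      (Lookup.lookupSteps 2N≤X 2Nτ≤X n<X (s≤s z≤n) m≤n
      (trans (m≡m%n+[m/n]*n m τ) (+-comm (m % τ) (b * τ))) (m%n<n m τ)
      (H c) (λ l → Order.lcp-≤ c (l ∸ N)) (cong (Order.lcp c) (n∸n≡0 N))
      c src pos (N + suc (Order.rank c pos)) c<4 srcValue (<-trans pos<n n<X)
      (m<m+n N (s≤s z≤n)) (+-monoʳ-< N (≤-<-trans (proj₁ (Order.rank-spec c pos<n)) n<N))
      (starts≡ pos) mins≡ siblings≡ lasts≡ env)
      where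
      subtracted : ∀ (υ′ : Reg → Carrier) →
        ∃[ l ] Tree.IsLast K (H c) m (N + suc (Order.rank c pos)) l × υ′ 0 ≡ υ 0 ∙ tableU c l ⁻¹ →
        υ′ 0 ≈ v ∙ belowSum c m pos ⁻¹
      subtracted _ (l , last , eq′) = ≈-trans (≈-reflexive eq′) (∙-cong υ0≈v (⁻¹-cong
        (≈-trans (≈-reflexive (sums≡ l))
        (Order.prefixSum-isLast c G (weights c) (s≤s z≤n) m≤n pos<n last))))

    n<word : n < 2 ^ W
    n<word = <X⇒<word n<X

    N<word : N < 2 ^ W
    N<word = <X⇒<word (<-≤-trans (m<m+n N (m^n>0 2 K)) 2N≤X)

    j+1<word : j + 1 < 2 ^ W
    j+1<word = ≤-<-trans (subst (_≤ n) (+-comm 1 j) j<n) n<word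

    m≡j+1∸i : m ≡ j + 1 ∸ i
    m≡j+1∸i = sym (trans (cong (_∸ i) (+-comm j 1)) (+-∸-assoc 1 i≤j))

    answer : Carrier
    answer = total ∙ belowSum 0 m i ⁻¹ ∙ belowSum 1 m i ⁻¹ ∙ belowSum 2 m j ⁻¹ ∙ belowSum 3 m j ⁻¹

    run-query : Σ[ t ∈ ℕ ] t ≤ 19 + (30 + b * 22 + (30 + b * 22 + (30 + b * 22 + (30 + b * 22)))) ×
      Answers query memory i j answer t
    run-query = outcome⇒answers (
      prologueSteps i≤j j+1<word (≤-<-trans τ≤n n<word) N<word m≡j+1∸i refl refl refl refl then λ env total≡ →
      lookupStep 0 0 i (m≤m+n 1 3) i<n (λ ρ → proj₁) env (≈-reflexive total≡) then λ env sum₀ →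
      lookupStep 1 0 i (m≤m+n 2 2) i<n (λ ρ → proj₁) env sum₀ then λ env sum₁ →
      lookupStep 2 1 j (m≤m+n 3 1) j<n (λ ρ → proj₁ ∘ proj₂) env sum₁ then
      lookupStep 3 1 j ≤-refl j<n (λ ρ → proj₁ ∘ proj₂))
      where
      i<n : i < n
      i<n = ≤-<-trans i≤j j<n

    matches : List ℕ
    matches = filter (λ x → Fwd.key m x ≟ Fwd.key m i) (upTo n)

    s+i≡j : j ∸ i + i ≡ j
    s+i≡j = m∸n+n≡m i≤j

    answer-matches : answer ≈ ∑ G (map (λ x → starts x ∙ ends (j ∸ i + x)) matches)
    answer-matches = begin
      answer
        ≈⟨ ∙-congʳ (∙-congʳ (∙-congʳ (∙-congʳ (∙-cong
             (∑-trichotomy G (λ x → Fwd.key m x <? Fwd.key m i) (λ x → Fwd.key m x ≟ Fwd.key m i)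
               (λ x → Fwd.cokey m x <? Fwd.cokey m i) (Fwd.key-cmp m i) starts (upTo n))
             (∑-trichotomy G (λ x → Bwd.key m x <? Bwd.key m j) (λ x → Bwd.key m x ≟ Bwd.key m j)
               (λ x → Bwd.cokey m x <? Bwd.cokey m j) (Bwd.key-cmp m j) ends (upTo n)))))) ⟩
      _ ≈⟨ subtract-four G _ _ _ _ _ _ ⟩
      ∑ G (map starts matches) ∙ ∑ G (map ends (filter (λ x → Bwd.key m x ≟ Bwd.key m j) (upTo n)))
        ≈⟨ ∙-congˡ (≈-reflexive endSum) ⟩
      ∑ G (map starts matches) ∙ ∑ G (map (ends ∘ (j ∸ i +_)) matches)
        ≈⟨ ∑-∙ G starts (ends ∘ (j ∸ i +_)) matches ⟨
      ∑ G (map (λ x → starts x ∙ ends (j ∸ i + x)) matches) ∎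
      where
      open import Relation.Binary.Reasoning.Setoid ≈-setoid
      endSum : ∑ G (map ends (filter (λ x → Bwd.key m x ≟ Bwd.key m j) (upTo n))) ≡
               ∑ G (map (ends ∘ (j ∸ i +_)) matches)
      endSum = trans
        (cong (∑ G ∘ map ends) (trans
          (cong (λ k → filter (λ x → Bwd.key m x ≟ Bwd.key m k) (upTo n)) (sym s+i≡j))
          (filter-bwd (subst (_< n) (sym s+i≡j) j<n))))
        (cong (∑ G) (sym (map-∘ matches)))

    -- `P` is kept abstract because the factor is cut with length `suc j ∸ i`, which equals `m` only
    -- propositionally.
    utility-matches : ∀ {P} → length P ≡ m → P ≡ slice (toList T) i m →
      ∑ G (map (λ x → starts x ∙ ends (j ∸ i + x)) matches) ≈ globalUtility G _≟ᴬ_ T w P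
    utility-matches {P} length≡ P≡ = ≈-sym (≈-trans (∑-map-cong window (Occ _≟ᴬ_ T P))
      (≈-reflexive (cong (∑ G ∘ map _) (filter-≐ _ _
        ( (λ {x} eq′ → slice⇒key m (trans (cong (slice (toList T) x) (sym length≡)) (trans eq′ P≡)))
        , (λ {x} eq′ → trans (cong (slice (toList T) x) length≡) (trans (key⇒slice m eq′) (sym P≡)))) (upTo n)))))
      where
      window : ∀ x → ∑ G (slice (toList w) x (length P)) ≈ starts x ∙ ends (j ∸ i + x)
      window x = ≈-trans (≈-reflexive (cong (λ k → ∑ G (slice (toList w) x k)) length≡))
        (≈-trans (∑-slice G (toList w) x m) (≈-trans (comm _ _)
          (∙-congˡ (≈-reflexive (cong S (trans (+-comm x m) refl))))))

    length-factor : length (slice (toList T) i (suc j ∸ i)) ≡ m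
    length-factor = trans (length-take (suc j ∸ i) _) (trans
      (m≤n⇒m⊓n≡m (subst (suc j ∸ i ≤_) (sym (trans (length-drop i (toList T)) (cong (_∸ i) (length-tabulate T))))
        (∸-monoˡ-≤ i j<n)))
      (+-∸-assoc 1 i≤j))

    query-correct : let P = slice (toList T) i (suc j ∸ i) in
      Σ[ t ∈ ℕ ] (t * τ ≤ 200 * (τ + length P)) × Answers query memory i j (globalUtility G _≟ᴬ_ T w P) t
    query-correct =
      let t , t≤ , σ , run , value , unchanged = run-query
      in t , query-time {t} {b} {τ} {m} t≤ (m/n*n≤m m τ) length-factor , σ , run
           , ≈-trans value (≈-trans answer-matches
               (utility-matches length-factor (cong (slice (toList T) i) (+-∸-assoc 1 i≤j))))
           , unchanged

theorem6p1 : ∀ {a c ℓ} →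
    Σ[ query ∈ Program ] Σ[ C ∈ ℕ ]
    ({A : Set a} (_≟_ : DecidableEquality A) (G : AbelianGroup c ℓ)
    (n : ℕ) (T : Vector A n) (w : Vector (AbelianGroup.Carrier G) n)
    (τ : ℕ) → 1 ≤ τ → τ ≤ n →
    (W : ℕ) → C * (n * τ) ≤ 2 ^ W →
    Σ[ D ∈ WordRAM.Memory G W ]
    (WordRAM.Memory.space D ≤ C * (n * τ))
    × (∀ (i j : Fin n) → toℕ i ≤ toℕ j →
    let P = factor T i j in
    Σ[ t ∈ ℕ ]
    (t * τ ≤ C * (τ + length P))
    × WordRAM.Answers G W query D (toℕ i) (toℕ j)
    (globalUtility G _≟_ T w P) t))
-- The constant 200 must exceed 80 for addresses to fit a word, and cover 160 for the cells of both
-- banks and 139 and 88 for the time.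
theorem6p1 = query , 200 , λ {A} _≟_ G n T w τ 1≤τ τ≤n W room →
  let 1≤n = ≤-trans 1≤τ τ≤n
      K , n<N , N≤2n = powerAbove n 1≤n
      module C = Construction _≟_ G n T w τ {{>-nonZero 1≤τ}} 1≤n τ≤n K n<N
                   -- Entries per table: at most 4n heap nodes, each with τ remainders.
                   (4 * (n * τ)) (heap-fits n τ N≤2n)
                   W (<-≤-trans (words-fit (n * τ) (*-mono-≤ 1≤n 1≤τ)) room)
  in C.memory , space-fits (n * τ) , λ i j i≤j → C.query-correct (toℕ i) (toℕ j) i≤j (toℕ<n j)
  where
  heap-fits : ∀ n τ {N} → N ≤ n + n → (N + N) * τ ≤ 4 * (n * τ)
  heap-fits n τ N≤2n = ≤-trans (*-monoˡ-≤ τ (+-mono-≤ N≤2n N≤2n)) (≤-reflexive (regroup n τ))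
    where
    regroup : ∀ n τ → (n + n + (n + n)) * τ ≡ 4 * (n * τ)
    regroup = solve-∀

  words-fit : ∀ k → 1 ≤ k → 4 * k * 20 < 200 * k
  words-fit k 1≤k = subst (_< 200 * k) (regroup k) (*-monoˡ-< k {{>-nonZero 1≤k}} (m≤m+n 81 119))
    where
    regroup : ∀ k → 80 * k ≡ 4 * k * 20
    regroup = solve-∀

  space-fits : ∀ k → 4 * k * 20 + 4 * k * 20 ≤ 200 * k
  space-fits k = ≤-trans (≤-reflexive (regroup k)) (*-monoˡ-≤ k (m≤m+n 160 40))
    where
    regroup : ∀ k → 4 * k * 20 + 4 * k * 20 ≡ 160 * k
    regroup = solve-∀
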